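{- Let $t$ be a fixed positive integer denoting the speed of the robber. (a) If $t\geq 2$, then there is a constant $c>0$ such that for every positive integer $n$ there exists a connected $n$-vertex graph whose cop number (for robber speed $t$) is at least $c\, n^{2/3}$, i.e. $\Omega(n^{2/3})$. (b) If $t\geq 4$, then there is a constant $c>0$ such that for every positive integer $n$ there exists a connected $n$-vertex graph whose cop number (for robber speed $t$) is at least $c\, n^{4/5}$, i.e. $\Omega(n^{4/5})$.
   Context: Cops and Robbers with a robber of speed $t$ on a finite simple connected graph $G$: first the cops are placed on vertices of their choice (several cops may share a vertex); then the robber, knowing their positions, chooses a vertex. The cops and the robber then move alternately, cops first. On the cops' turn each cop either stays put or moves along an edge to an adjacent vertex. On the robber's turn she moves along any path of length at most $t$ from her current position (possibly staying put), but may not pass through a vertex occupied by a cop. The cops win if at some point a cop occupies the robber's vertex; otherwise the robber wins. The cop number of $G$ (for robber speed $t$) is the minimum number of cops that guarantees the cops can win. -}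

module Defs where

open import Data.Nat using (ℕ; zero; suc; _≤_; _^_; _*_)
open import Data.Fin using (Fin)
open import Data.Product using (Σ; ∃; _×_; _,_)
open import Data.Sum using (_⊎_)
open import Relation.Binary.PropositionalEquality using (_≡_; _≢_)
open import Relation.Nullary using (¬_)

record Graph (n : ℕ) : Set₁ where
  field
    Adj    : Fin n → Fin n → Set
    sym    : ∀ {u v} → Adj u v → Adj v u
    irrefl : ∀ {u} → ¬ Adj u u
open Graph public

data Walk {n : ℕ} (G : Graph n) : Fin n → Fin n → Set where
  here : ∀ {u} → Walk G u u
  step : ∀ {u v w} → Adj G u v → Walk G v w → Walk G u w

Connected : {n : ℕ} → Graph n → Set
Connected {n} G = ∀ (u v : Fin n) → Walk G u v

Cops : ℕ → ℕ → Set
Cops n m = Fin m → Fin n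

Free : {n m : ℕ} → Cops n m → Fin n → Set
Free cs v = ∀ i → cs i ≢ v

Caught : {n m : ℕ} → Cops n m → Fin n → Set
Caught cs r = ∃ λ i → cs i ≡ r

CopMove : {n m : ℕ} → Graph n → Cops n m → Cops n m → Set
CopMove G cs cs' = ∀ i → (cs' i ≡ cs i) ⊎ Adj G (cs i) (cs' i)

data RobPath {n m : ℕ} (G : Graph n) (cs : Cops n m) : ℕ → Fin n → Fin n → Set where
  stay : ∀ {k r} → RobPath G cs k r r
  move : ∀ {k r s r'} → Adj G r s → Free cs s → RobPath G cs k s r' → RobPath G cs (suc k) r r'

-- CopWin G t cs r : in the position where the cops are at cs, the robber
-- (of speed t) is at r and the cops are to move, the cops can force capture.
data CopWin {n m : ℕ} (G : Graph n) (t : ℕ) : Cops n m → Fin n → Set where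
  caught : ∀ {cs r} → Caught cs r → CopWin G t cs r
  play   : ∀ {cs r} (cs' : Cops n m) → CopMove G cs cs' →
           (Caught cs' r ⊎ (∀ r' → RobPath G cs' t r r' → CopWin G t cs' r')) →
           CopWin G t cs r

CopsWin : {n : ℕ} → Graph n → ℕ → ℕ → Set
CopsWin {n} G t m = Σ (Cops n m) λ cs → ∀ (r : Fin n) → CopWin G t cs r

-- "cop number of G (speed t) ≥ c · n^(a/b)" with c = p/q:
-- every winning number m of cops satisfies m ≥ (p/q) n^(a/b),
-- i.e. p^b · n^a ≤ (q · m)^b.
CopNumberAtLeast : {n : ℕ} → Graph n → (t p q a b : ℕ) → Set
CopNumberAtLeast {n} G t p q a b = ∀ m → CopsWin G t m → p ^ b * n ^ a ≤ (q * m) ^ b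

{-# OPTIONS --safe #-}
module Submission where

-- In a q-regular graph without cycles of length at most 2t + 2, the q ^ t or so non-backtracking walks of length t from
-- the robber's position end in distinct vertices. Let the danger of a vertex u be the number, summed over the cops, of
-- walks of length t from u that meet the closed neighbourhood of the cop. A robber at u whose danger is below q ^ t / 4
-- survives the cops' move, and most walks from u remain unblocked. The absence of short cycles bounds by a constant times
-- q ^ t the contribution of one cop to the total danger of the ends of the walks it does not block. So m cops with m at
-- most a constant times q ^ t leave an unblocked walk whose end again has danger below q ^ t / 4.
--
-- The affine parts of generalized quadrangles (t = 2) and hexagons (t = 4) over the field with p elements are such graphs
-- with q = p and 2 p ^ (t + 1) vertices. Their short cycles are excluded by Vandermonde arguments modulo p, and
-- Chebyshev-type estimates give a suitable prime p within a constant factor of any bound. A faster robber is at least as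
-- hard to catch.

-- The exponent is t / (t + 1) because of the order of q ^ t cops are needed on of the order of q ^
-- (t + 1) vertices. A closed neighbourhood has q + 1 vertices, so the plain count lets one cop
-- contribute of the order of q ^ (t + 1) to the total danger of the ends. The factor q is saved
-- because the walks counted already avoid the cop: a continuation towards it either retraces the
-- walk, or prolongs it without backtracking, and there are few of the latter by uniqueness. Before
-- the first move nothing is avoided, and walks of length t + 1 supply the factor instead. For the
-- hexagon the linear relations are too weak: around five lines they are four equations in five
-- differences, and for distinct nodes a one-dimensional solution space remains. The last coordinate
-- adds one quadratic relation, tractable because the form x z - y ^ 2 vanishes on the directions (1
-- , a , a ^ 2) of all steps. Sums run over all words of colours, backtracking ones included, so
-- that they are iterated sums over `Fin q`; backtracking affects only a small fraction once q is
-- large.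

open import Defs hiding (sym)
open import Data.Nat using (ℕ; _≤_; _<_)
open import Data.Nat.Properties using (m≤m+n)
open import Data.Product using (Σ; ∃; _×_; _,_)

-- Congruences that exclude short cycles.

module Cycles where

  open import Data.Empty using (⊥)
  open import Data.Integer using (ℤ; +_; -_; _+_; _-_; _*_; 0ℤ; 1ℤ; ∣_∣)
  import Data.Integer.Properties as ℤ
  open import Data.Integer.Divisibility.Signed using (_∣_; ∣-refl; ∣m∣n⇒∣m+n; ∣m∣n⇒∣m-n; ∣n⇒∣m*n; ∣ᵤ⇒∣; ∣⇒∣ᵤ)
  open import Data.Integer.Tactic.RingSolver using (solve-∀)
  open import Data.Nat using (ℕ; zero; suc)
  open import Data.Fin using (Fin; toℕ)
  open import Data.Fin.Properties using (_≟_; toℕ-injective; toℕ<n)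
  import Data.Nat.Properties as ℕ
  open import Data.Nat.Primality using (Prime; euclidsLemma)
  import Data.Nat as ℕ
  import Data.Nat.Divisibility as ℕ
  open import Data.Product using (_×_; _,_; proj₁; proj₂)
  open import Data.Sum using (_⊎_; inj₁; inj₂; [_,_]′)
  open import Relation.Binary.PropositionalEquality using (_≡_; _≢_; refl; sym; trans; cong; subst)
  open import Relation.Nullary using (¬_; contradiction; yes; no)
  open import Function using (_∘_)

  record Line : Set where
    constructor line
    field x y z u v : ℤ
  open Line

  -- The polar form of x z - y ^ 2, evaluated at (x , y , z) and (1 , a , a ^ 2). The second vector
  -- is isotropic, and a step through a changes (x , y , z) by a multiple of it.
  G : ℤ → Line → ℤ
  G a l = a * a * x l - (+ 2) * a * y l + z l

  module Modular (p : ℕ) (prime : Prime p) where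

    Z : ℤ → Set
    Z i = + p ∣ i

    Z-cancel : ∀ {i j} → Z (i * j) → ¬ Z i → Z j
    Z-cancel {i} {j} ij ¬i = [ (λ d → contradiction (∣ᵤ⇒∣ d) ¬i) , ∣ᵤ⇒∣ ]′
      (euclidsLemma _ _ prime (subst (p ℕ.∣_) (ℤ.∣i*j∣≡∣i∣*∣j∣ i j) (∣⇒∣ᵤ ij)))

    Z-prime : ∀ {i j} → Z (i * j) → ¬ Z i → ¬ Z j → ⊥
    Z-prime ij ¬i ¬j = ¬j (Z-cancel ij ¬i)

    infixl 6 _⊕_ _⊖_
    infixr 7 _⊛_

    _⊕_ : ∀ {i j} → Z i → Z j → Z (i + j)
    _⊕_ = ∣m∣n⇒∣m+n

    _⊖_ : ∀ {i j} → Z i → Z j → Z (i - j)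
    _⊖_ = ∣m∣n⇒∣m-n

    _⊛_ : ∀ i {j} → Z j → Z (i * j)
    i ⊛ h = ∣n⇒∣m*n i h

    _by_ : ∀ {i j} → Z i → i ≡ j → Z j
    h by eq = subst Z eq h

    infix 2 _by_

    nz* : ∀ {i j} → ¬ Z i → ¬ Z j → ¬ Z (i * j)
    nz* ¬i ¬j h = Z-prime h ¬i ¬j

    -- The congruences forced on two lines l and l' through a common point with first coordinate a.
    record Step₃ (a : ℤ) (l l' : Line) : Set where
      constructor step₃
      field
        Δy : Z ((y l - y l') - a * (x l - x l'))
        Δz : Z ((z l - z l') - a * a * (x l - x l'))
    open Step₃

    record Step₅ (a : ℤ) (l l' : Line) : Set where
      constructor step₅
      field
        Δyz : Step₃ a l l'
        Δu  : Z ((u l - u l') - a * a * a * (x l - x l'))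
        Δv  : Z ((v l - v l') - (x l - x l') * a * G a l')
    open Step₅

    no-2-cycle : ∀ {a₁ a₂ l₀ l₁} → Step₃ a₁ l₀ l₁ → Step₃ a₂ l₁ l₀ →
      ¬ Z (a₁ - a₂) → ¬ Z (x l₀ - x l₁) → ⊥
    no-2-cycle {a₁} {a₂} {l₀} {l₁} s₁ s₂ a₁≠a₂ = 
      Z-prime (- 1ℤ ⊛ (Δy s₁ ⊕ Δy s₂) by eq a₁ a₂ (x l₀) (x l₁) (y l₀) (y l₁)) a₁≠a₂
      where
      eq : ∀ a₁ a₂ x₀ x₁ y₀ y₁ →
        - 1ℤ * (((y₀ - y₁) - a₁ * (x₀ - x₁)) + ((y₁ - y₀) - a₂ * (x₁ - x₀))) ≡ (a₁ - a₂) * (x₀ - x₁)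
      eq = solve-∀

    -- The differences ξ of x around the cycle are orthogonal to 1, a and a ^ 2. Pairing them with
    -- (a - a₂) * (a - a₃) leaves only the term of a₁.
    no-3-cycle : ∀ {a₁ a₂ a₃ l₀ l₁ l₂} → Step₃ a₁ l₀ l₁ → Step₃ a₂ l₁ l₂ → Step₃ a₃ l₂ l₀ →
      ¬ Z (a₁ - a₂) → ¬ Z (a₁ - a₃) → ¬ Z (x l₀ - x l₁) → ⊥
    no-3-cycle {a₁} {a₂} {a₃} {l₀} {l₁} {l₂} s₁ s₂ s₃ a₁≠a₂ a₁≠a₃ =
      Z-prime ((a₂ + a₃) ⊛ (Δy s₁ ⊕ Δy s₂ ⊕ Δy s₃) ⊖ (Δz s₁ ⊕ Δz s₂ ⊕ Δz s₃)
        by eq a₁ a₂ a₃ (x l₀) (x l₁) (x l₂) (y l₀) (y l₁) (y l₂) (z l₀) (z l₁) (z l₂))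
        (nz* a₁≠a₂ a₁≠a₃)
      where
      eq : ∀ a₁ a₂ a₃ x₀ x₁ x₂ y₀ y₁ y₂ z₀ z₁ z₂ →
        (a₂ + a₃) * (((y₀ - y₁) - a₁ * (x₀ - x₁)) + ((y₁ - y₂) - a₂ * (x₁ - x₂)) + ((y₂ - y₀) - a₃ * (x₂ - x₀)))
        - (((z₀ - z₁) - a₁ * a₁ * (x₀ - x₁)) + ((z₁ - z₂) - a₂ * a₂ * (x₁ - x₂)) + ((z₂ - z₀) - a₃ * a₃ * (x₂ - x₀)))
        ≡ (a₁ - a₂) * (a₁ - a₃) * (x₀ - x₁)
      eq = solve-∀

    -- The polar form of (1 , a , a ^ 2) and (1 , b , b ^ 2) is (b - a) ^ 2. In particular `G a`
    -- does not change along a step through a.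
    G-step : ∀ b {a l l'} → Step₃ a l l' → Z ((G b l - G b l') - (x l - x l') * ((b - a) * (b - a)))
    G-step b {a} {l} {l'} s = Δz s ⊖ ((+ 2) * b) ⊛ Δy s
      by eq a b (x l) (x l') (y l) (y l') (z l) (z l')
      where
      eq : ∀ a b x x' y y' z z' →
        ((z - z') - a * a * (x - x')) - ((+ 2) * b) * ((y - y') - a * (x - x'))
        ≡ ((b * b * x - (+ 2) * b * y + z) - (b * b * x' - (+ 2) * b * y' + z')) - (x - x') * ((b - a) * (b - a))
      eq = solve-∀

    conic : Line → ℤ
    conic l = x l * z l - y l * y l

    -- Hence the terms (x l - x l') * G a l' telescope around a cycle.
    conic-step : ∀ {a l l'} → Step₃ a l l' → Z ((conic l - conic l') - (x l - x l') * G a l')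
    conic-step {a} {l} {l'} s =
      x l ⊛ Δz s ⊖ (y l + y l' + a * (x l - x l')) ⊛ Δy s
      by eq a (x l) (x l') (y l) (y l') (z l) (z l')
      where
      eq : ∀ a x x' y y' z z' →
        x * ((z - z') - a * a * (x - x')) - (y + y' + a * (x - x')) * ((y - y') - a * (x - x'))
        ≡ ((x * z - y * y) - (x' * z' - y' * y')) - (x - x') * (a * a * x' - (+ 2) * a * y' + z')
      eq = solve-∀

    tel : ∀ t₀ t₁ t₂ t₃ t₄ {e₁ e₂ e₃ e₄ e₅} →
      Z ((t₀ - t₁) - e₁) → Z ((t₁ - t₂) - e₂) → Z ((t₂ - t₃) - e₃) → Z ((t₃ - t₄) - e₄) → Z ((t₄ - t₀) - e₅) →
      Z (e₁ + e₂ + e₃ + e₄ + e₅)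
    tel t₀ t₁ t₂ t₃ t₄ {e₁} {e₂} {e₃} {e₄} {e₅} h₁ h₂ h₃ h₄ h₅ =
      - 1ℤ ⊛ (h₁ ⊕ h₂ ⊕ h₃ ⊕ h₄ ⊕ h₅) by eq t₀ t₁ t₂ t₃ t₄ e₁ e₂ e₃ e₄ e₅
      where
      eq : ∀ t₀ t₁ t₂ t₃ t₄ e₁ e₂ e₃ e₄ e₅ →
        - 1ℤ * (((t₀ - t₁) - e₁) + ((t₁ - t₂) - e₂) + ((t₂ - t₃) - e₃) + ((t₃ - t₄) - e₄) + ((t₄ - t₀) - e₅))
        ≡ e₁ + e₂ + e₃ + e₄ + e₅
      eq = solve-∀

    Z-self : ∀ i → Z (i - i)
    Z-self i = 0ℤ ⊛ ∣-refl by eq i (+ p)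
      where
      eq : ∀ i k → 0ℤ * k ≡ i - i
      eq = solve-∀

    record Moments (ξ₁ ξ₂ ξ₃ ξ₄ ξ₅ a₁ a₂ a₃ a₄ a₅ : ℤ) : Set where
      constructor moments
      field
        M₀ : Z (ξ₁ + ξ₂ + ξ₃ + ξ₄ + ξ₅)
        M₁ : Z (a₁ * ξ₁ + a₂ * ξ₂ + a₃ * ξ₃ + a₄ * ξ₄ + a₅ * ξ₅)
        M₂ : Z (a₁ * a₁ * ξ₁ + a₂ * a₂ * ξ₂ + a₃ * a₃ * ξ₃ + a₄ * a₄ * ξ₄ + a₅ * a₅ * ξ₅)
        M₃ : Z (a₁ * a₁ * a₁ * ξ₁ + a₂ * a₂ * a₂ * ξ₂ + a₃ * a₃ * a₃ * ξ₃ + a₄ * a₄ * a₄ * ξ₄ + a₅ * a₅ * a₅ * ξ₅)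
    open Moments

    rotate : ∀ {ξ₁ ξ₂ ξ₃ ξ₄ ξ₅ a₁ a₂ a₃ a₄ a₅} → Moments ξ₁ ξ₂ ξ₃ ξ₄ ξ₅ a₁ a₂ a₃ a₄ a₅ → Moments ξ₂ ξ₃ ξ₄ ξ₅ ξ₁ a₂ a₃ a₄ a₅ a₁
    rotate {ξ₁} {ξ₂} {ξ₃} {ξ₄} {ξ₅} {a₁} {a₂} {a₃} {a₄} {a₅} m = moments
      (M₀ m by eq ξ₁ ξ₂ ξ₃ ξ₄ ξ₅)
      (M₁ m by eq (a₁ * ξ₁) (a₂ * ξ₂) (a₃ * ξ₃) (a₄ * ξ₄) (a₅ * ξ₅))
      (M₂ m by eq (a₁ * a₁ * ξ₁) (a₂ * a₂ * ξ₂) (a₃ * a₃ * ξ₃) (a₄ * a₄ * ξ₄) (a₅ * a₅ * ξ₅))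
      (M₃ m by eq (a₁ * a₁ * a₁ * ξ₁) (a₂ * a₂ * a₂ * ξ₂) (a₃ * a₃ * a₃ * ξ₃) (a₄ * a₄ * a₄ * ξ₄) (a₅ * a₅ * a₅ * ξ₅))
      where
      eq : ∀ t₁ t₂ t₃ t₄ t₅ → t₁ + t₂ + t₃ + t₄ + t₅ ≡ t₂ + t₃ + t₄ + t₅ + t₁
      eq = solve-∀

    cubic : ∀ {ξ₁ ξ₂ ξ₃ ξ₄ ξ₅ a₁ a₂ a₃ a₄ a₅} → Moments ξ₁ ξ₂ ξ₃ ξ₄ ξ₅ a₁ a₂ a₃ a₄ a₅ → ∀ α β γ →
      let f = λ a → (a - α) * (a - β) * (a - γ) in
      Z (f a₁ * ξ₁ + f a₂ * ξ₂ + f a₃ * ξ₃ + f a₄ * ξ₄ + f a₅ * ξ₅)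
    cubic {ξ₁} {ξ₂} {ξ₃} {ξ₄} {ξ₅} {a₁} {a₂} {a₃} {a₄} {a₅} m α β γ =
      M₃ m ⊖ (α + β + γ) ⊛ M₂ m ⊕ (α * β + β * γ + γ * α) ⊛ M₁ m ⊖ (α * β * γ) ⊛ M₀ m
      by eq ξ₁ ξ₂ ξ₃ ξ₄ ξ₅ a₁ a₂ a₃ a₄ a₅ α β γ
      where
      eq : ∀ ξ₁ ξ₂ ξ₃ ξ₄ ξ₅ a₁ a₂ a₃ a₄ a₅ α β γ →
        (a₁ * a₁ * a₁ * ξ₁ + a₂ * a₂ * a₂ * ξ₂ + a₃ * a₃ * a₃ * ξ₃ + a₄ * a₄ * a₄ * ξ₄ + a₅ * a₅ * a₅ * ξ₅)
        - (α + β + γ) * (a₁ * a₁ * ξ₁ + a₂ * a₂ * ξ₂ + a₃ * a₃ * ξ₃ + a₄ * a₄ * ξ₄ + a₅ * a₅ * ξ₅)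
        + (α * β + β * γ + γ * α) * (a₁ * ξ₁ + a₂ * ξ₂ + a₃ * ξ₃ + a₄ * ξ₄ + a₅ * ξ₅)
        - (α * β * γ) * (ξ₁ + ξ₂ + ξ₃ + ξ₄ + ξ₅)
        ≡ ((a₁ - α) * (a₁ - β) * (a₁ - γ)) * ξ₁ + ((a₂ - α) * (a₂ - β) * (a₂ - γ)) * ξ₂ + ((a₃ - α) * (a₃ - β) * (a₃ - γ)) * ξ₃
          + ((a₄ - α) * (a₄ - β) * (a₄ - γ)) * ξ₄ + ((a₅ - α) * (a₅ - β) * (a₅ - γ)) * ξ₅
      eq = solve-∀

    OneOf : (α β γ a : ℤ) → Set
    OneOf α β γ a = a ≡ α ⊎ a ≡ β ⊎ a ≡ γ

    -- The cubic with roots α, β, γ kills every term but the first. Three roots can cover the four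
    -- other nodes only if some of these coincide, so this handles exactly the degenerate cycles.
    isolate : ∀ {ξ₁ ξ₂ ξ₃ ξ₄ ξ₅ a₁ a₂ a₃ a₄ a₅} → Moments ξ₁ ξ₂ ξ₃ ξ₄ ξ₅ a₁ a₂ a₃ a₄ a₅ → ∀ α β γ →
      OneOf α β γ a₂ → OneOf α β γ a₃ → OneOf α β γ a₄ → OneOf α β γ a₅ →
      ¬ Z (a₁ - α) → ¬ Z (a₁ - β) → ¬ Z (a₁ - γ) → ¬ Z ξ₁ → ⊥
    isolate {ξ₁} {ξ₂} {ξ₃} {ξ₄} {ξ₅} {a₁} {a₂} {a₃} {a₄} {a₅} m α β γ i₂ i₃ i₄ i₅ ¬α ¬β ¬γ =
      Z-prime (cubic m α β γ ⊖ vanish ξ₂ i₂ ⊖ vanish ξ₃ i₃ ⊖ vanish ξ₄ i₄ ⊖ vanish ξ₅ i₅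
          by eq (f a₁ * ξ₁) (f a₂ * ξ₂) (f a₃ * ξ₃) (f a₄ * ξ₄) (f a₅ * ξ₅))
        (nz* (nz* ¬α ¬β) ¬γ)
      where
      f : ℤ → ℤ
      f a = (a - α) * (a - β) * (a - γ)

      eq : ∀ t₁ t₂ t₃ t₄ t₅ → t₁ + t₂ + t₃ + t₄ + t₅ - t₂ - t₃ - t₄ - t₅ ≡ t₁
      eq = solve-∀

      eqα : ∀ a β γ ξ → ((a - β) * (a - γ) * ξ) * (a - a) ≡ (a - a) * (a - β) * (a - γ) * ξ
      eqα = solve-∀

      eqβ : ∀ a α γ ξ → ((a - α) * (a - γ) * ξ) * (a - a) ≡ (a - α) * (a - a) * (a - γ) * ξ
      eqβ = solve-∀

      eqγ : ∀ a α β ξ → ((a - α) * (a - β) * ξ) * (a - a) ≡ (a - α) * (a - β) * (a - a) * ξ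
      eqγ = solve-∀

      vanish : ∀ {a} ξ → OneOf α β γ a → Z (f a * ξ)
      vanish ξ (inj₁ refl)        = ((α - β) * (α - γ) * ξ) ⊛ Z-self α by eqα α β γ ξ
      vanish ξ (inj₂ (inj₁ refl)) = ((β - α) * (β - γ) * ξ) ⊛ Z-self β by eqβ β α γ ξ
      vanish ξ (inj₂ (inj₂ refl)) = ((γ - α) * (γ - β) * ξ) ⊛ Z-self γ by eqγ γ α β ξ

    Cycle : (a₁ a₂ a₃ a₄ a₅ : ℤ) (l₀ l₁ l₂ l₃ l₄ : Line) → Set
    Cycle a₁ a₂ a₃ a₄ a₅ l₀ l₁ l₂ l₃ l₄ =
      Step₅ a₁ l₀ l₁ × Step₅ a₂ l₁ l₂ × Step₅ a₃ l₂ l₃ × Step₅ a₄ l₃ l₄ × Step₅ a₅ l₄ l₀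

    cycle-moments : ∀ {a₁ a₂ a₃ a₄ a₅ l₀ l₁ l₂ l₃ l₄} → Cycle a₁ a₂ a₃ a₄ a₅ l₀ l₁ l₂ l₃ l₄ →
      Moments (x l₀ - x l₁) (x l₁ - x l₂) (x l₂ - x l₃) (x l₃ - x l₄) (x l₄ - x l₀) a₁ a₂ a₃ a₄ a₅
    cycle-moments {l₀ = l₀} {l₁} {l₂} {l₃} {l₄} (s₁ , s₂ , s₃ , s₄ , s₅) = moments
      (tel (x l₀) (x l₁) (x l₂) (x l₃) (x l₄) 
        (Z-self (x l₀ - x l₁)) (Z-self (x l₁ - x l₂)) (Z-self (x l₂ - x l₃)) (Z-self (x l₃ - x l₄)) (Z-self (x l₄ - x l₀)))
      (tel (y l₀) (y l₁) (y l₂) (y l₃) (y l₄) (Δy (Δyz s₁)) (Δy (Δyz s₂)) (Δy (Δyz s₃)) (Δy (Δyz s₄)) (Δy (Δyz s₅)))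
      (tel (z l₀) (z l₁) (z l₂) (z l₃) (z l₄) (Δz (Δyz s₁)) (Δz (Δyz s₂)) (Δz (Δyz s₃)) (Δz (Δyz s₄)) (Δz (Δyz s₅)))
      (tel (u l₀) (u l₁) (u l₂) (u l₃) (u l₄) (Δu s₁) (Δu s₂) (Δu s₃) (Δu s₄) (Δu s₅))

    -- Telescoping v gives the weights a, telescoping `conic` gives the weights 1. Their combination
    -- allows c to be chosen so that the terms of one node disappear.
    weighted : ∀ {a₁ a₂ a₃ a₄ a₅ l₀ l₁ l₂ l₃ l₄} → Cycle a₁ a₂ a₃ a₄ a₅ l₀ l₁ l₂ l₃ l₄ → ∀ c →
      Z ((x l₀ - x l₁) * (a₁ - c) * G a₁ l₁ + (x l₁ - x l₂) * (a₂ - c) * G a₂ l₂ + (x l₂ - x l₃) * (a₃ - c) * G a₃ l₃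
        + (x l₃ - x l₄) * (a₄ - c) * G a₄ l₄ + (x l₄ - x l₀) * (a₅ - c) * G a₅ l₀)
    weighted {a₁} {a₂} {a₃} {a₄} {a₅} {l₀} {l₁} {l₂} {l₃} {l₄} (s₁ , s₂ , s₃ , s₄ , s₅) c =
      tel (v l₀) (v l₁) (v l₂) (v l₃) (v l₄) (Δv s₁) (Δv s₂) (Δv s₃) (Δv s₄) (Δv s₅)
      ⊖ c ⊛ tel (conic l₀) (conic l₁) (conic l₂) (conic l₃) (conic l₄) (conic-step (Δyz s₁)) (conic-step (Δyz s₂))
              (conic-step (Δyz s₃)) (conic-step (Δyz s₄)) (conic-step (Δyz s₅))
      by eq (x l₀ - x l₁) (x l₁ - x l₂) (x l₂ - x l₃) (x l₃ - x l₄) (x l₄ - x l₀) a₁ a₂ a₃ a₄ a₅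
            (G a₁ l₁) (G a₂ l₂) (G a₃ l₃) (G a₄ l₄) (G a₅ l₀) c
      where
      eq : ∀ ξ₁ ξ₂ ξ₃ ξ₄ ξ₅ a₁ a₂ a₃ a₄ a₅ g₁ g₂ g₃ g₄ g₅ c →
        (ξ₁ * a₁ * g₁ + ξ₂ * a₂ * g₂ + ξ₃ * a₃ * g₃ + ξ₄ * a₄ * g₄ + ξ₅ * a₅ * g₅)
        - c * (ξ₁ * g₁ + ξ₂ * g₂ + ξ₃ * g₃ + ξ₄ * g₄ + ξ₅ * g₅)
        ≡ ξ₁ * (a₁ - c) * g₁ + ξ₂ * (a₂ - c) * g₂ + ξ₃ * (a₃ - c) * g₃ + ξ₄ * (a₄ - c) * g₄ + ξ₅ * (a₅ - c) * g₅
      eq = solve-∀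

    -- A degenerate step makes a 4-cycle a 5-cycle with last difference zero, so that the moments
    -- and `weighted` serve both lengths.
    step-refl : ∀ a l → Step₅ a l l
    step-refl a (line x y z u v) = step₅ (step₃ (zero₁ y x a) (zero₁ z x (a * a))) (zero₁ u x (a * a * a))
      (0ℤ ⊛ ∣-refl by eq₂ v x a (G a (line x y z u v)) (+ p))
      where
      eq₁ : ∀ t x c k → 0ℤ * k ≡ (t - t) - c * (x - x)
      eq₁ = solve-∀

      zero₁ : ∀ t x c → Z ((t - t) - c * (x - x))
      zero₁ t x c = 0ℤ ⊛ ∣-refl by eq₁ t x c (+ p)

      eq₂ : ∀ t x a g k → 0ℤ * k ≡ (t - t) - (x - x) * a * g
      eq₂ = solve-∀

    -- The case of a 4-cycle that the moments do not exclude.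
    no-alternating-4-cycle : ∀ {α β l₀ l₁ l₂ l₃} →
      Step₅ α l₀ l₁ → Step₅ β l₁ l₂ → Step₅ α l₂ l₃ → Step₅ β l₃ l₀ →
      ¬ Z (α - β) → ¬ Z (x l₀ - x l₁) → ¬ Z (x l₁ - x l₂) → ⊥
    no-alternating-4-cycle {α} {β} {l₀} {l₁} {l₂} {l₃} s₁ s₂ s₃ s₄ α≠β ξ₁≠0 ξ₂≠0 =
      -- Taking c = β leaves only the steps through α. Since ξ₁ + ξ₃ vanishes, what remains is ξ₁ *
      -- (α - β) * (G α l₁ - G α l₃), and `G-step` evaluates the last factor as ξ₂ * (α - β) ^ 2.
      Z-prime (weighted cyc β
          ⊖ ((α - β) * G α l₃) ⊛ ξ₁+ξ₃
          ⊖ ((x l₀ - x l₁) * (α - β)) ⊛ (G-step α (Δyz s₂) ⊕ G-step α (Δyz s₃))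
        by eq₂ (x l₀ - x l₁) (x l₁ - x l₂) (x l₂ - x l₃) (x l₃ - x l₀) (x l₀ - x l₀) α β
            (G α l₁) (G α l₂) (G α l₃) (G β l₂) (G β l₀))
        (nz* ξ₁≠0 ξ₂≠0) (nz* α≠β (nz* α≠β α≠β))
      where
      cyc : Cycle α β α β β l₀ l₁ l₂ l₃ l₀
      cyc = s₁ , s₂ , s₃ , s₄ , step-refl β l₀

      eq₁ : ∀ ξ₁ ξ₂ ξ₃ ξ₄ ξ₅ α β →
        (α * ξ₁ + β * ξ₂ + α * ξ₃ + β * ξ₄ + β * ξ₅) - β * (ξ₁ + ξ₂ + ξ₃ + ξ₄ + ξ₅) ≡ (α - β) * (ξ₁ + ξ₃)
      eq₁ = solve-∀

      m : Moments (x l₀ - x l₁) (x l₁ - x l₂) (x l₂ - x l₃) (x l₃ - x l₀) (x l₀ - x l₀) α β α β β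
      m = cycle-moments cyc

      ξ₁+ξ₃ : Z ((x l₀ - x l₁) + (x l₂ - x l₃))
      ξ₁+ξ₃ = Z-cancel (M₁ m ⊖ β ⊛ M₀ m
        by eq₁ (x l₀ - x l₁) (x l₁ - x l₂) (x l₂ - x l₃) (x l₃ - x l₀) (x l₀ - x l₀) α β) α≠β

      eq₂ : ∀ ξ₁ ξ₂ ξ₃ ξ₄ ξ₅ α β g₁ g₂ g₃ h₂ h₀ →
        (ξ₁ * (α - β) * g₁ + ξ₂ * (β - β) * h₂ + ξ₃ * (α - β) * g₃ + ξ₄ * (β - β) * h₀ + ξ₅ * (β - β) * h₀)
        - ((α - β) * g₃) * (ξ₁ + ξ₃)
        - (ξ₁ * (α - β)) * (((g₁ - g₂) - ξ₂ * ((α - β) * (α - β))) + ((g₂ - g₃) - ξ₃ * ((α - α) * (α - α))))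
        ≡ (ξ₁ * ξ₂) * ((α - β) * ((α - β) * (α - β)))
      eq₂ = solve-∀

    ι : Fin p → ℤ
    ι a = + toℕ a

    ι-injective : ∀ {a b} → Z (ι a - ι b) → a ≡ b
    ι-injective {a} {b} h = toℕ-injective (ℤ.+-injective (ℤ.i-j≡0⇒i≡j (ι a) (ι b) (ℤ.∣i∣≡0⇒i≡0 (small _ ∣a-b∣<p (∣⇒∣ᵤ h)))))
      where
      small : ∀ n → n ℕ.< p → p ℕ.∣ n → n ≡ 0
      small zero    _   _   = refl
      small (suc n) n<p p∣n = contradiction p∣n (ℕ.>⇒∤ n<p)

      ∣a-b∣<p : ∣ ι a - ι b ∣ ℕ.< p
      ∣a-b∣<p = ℕ.≤-<-trans
        (ℕ.≤-trans (ℕ.≤-reflexive (cong ∣_∣ (ℤ.[+m]-[+n]≡m⊖n (toℕ a) (toℕ b)))) (ℤ.∣m⊝n∣≤m⊔n (toℕ a) (toℕ b)))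
        (ℕ.⊔-lub (toℕ<n a) (toℕ<n b))

    ι-≢ : ∀ {a b} → a ≢ b → ¬ Z (ι a - ι b)
    ι-≢ a≢b h = a≢b (ι-injective h)

    module _ {a₁ a₂ a₃ a₄ : Fin p} {l₀ l₁ l₂ l₃ : Line}
      (s₁ : Step₅ (ι a₁) l₀ l₁) (s₂ : Step₅ (ι a₂) l₁ l₂) (s₃ : Step₅ (ι a₃) l₂ l₃) (s₄ : Step₅ (ι a₄) l₃ l₀)
      (a₁≢a₂ : a₁ ≢ a₂) (a₂≢a₃ : a₂ ≢ a₃) (a₄≢a₁ : a₄ ≢ a₁)
      (ξ₁ : ¬ Z (x l₀ - x l₁)) (ξ₂ : ¬ Z (x l₁ - x l₂)) where

      private
        m : Moments (x l₀ - x l₁) (x l₁ - x l₂) (x l₂ - x l₃) (x l₃ - x l₀) (x l₀ - x l₀) (ι a₁) (ι a₂) (ι a₃) (ι a₄) (ι a₄)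
        m = cycle-moments (s₁ , s₂ , s₃ , s₄ , step-refl (ι a₄) l₀)

      no-4-cycle : ⊥
      no-4-cycle with a₁ ≟ a₃ | a₂ ≟ a₄
      ... | no a₁≢a₃ | _        = isolate m (ι a₂) (ι a₃) (ι a₄) (inj₁ refl) (inj₂ (inj₁ refl)) (inj₂ (inj₂ refl)) (inj₂ (inj₂ refl))
        (ι-≢ a₁≢a₂) (ι-≢ a₁≢a₃) (ι-≢ (a₄≢a₁ ∘ sym)) ξ₁
      ... | yes refl | no a₂≢a₄ = isolate (rotate m) (ι a₁) (ι a₄) (ι a₄) (inj₁ refl) (inj₂ (inj₁ refl)) (inj₂ (inj₁ refl)) (inj₁ refl)
        (ι-≢ a₂≢a₃) (ι-≢ a₂≢a₄) (ι-≢ a₂≢a₄) ξ₂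
      ... | yes refl | yes refl = no-alternating-4-cycle s₁ s₂ s₃ s₄ (ι-≢ a₁≢a₂) ξ₁ ξ₂

    -- If two nodes of a 5-cycle coincide, some other node is isolated.
    coincident : ∀ {ξ₁ ξ₂ ξ₃ ξ₄ ξ₅ a₁ a₂ a₃ a₄ a₅} →
      Moments ξ₁ ξ₂ ξ₃ ξ₄ ξ₅ (ι a₁) (ι a₂) (ι a₃) (ι a₄) (ι a₅) →
      a₃ ≢ a₄ → a₄ ≢ a₅ → a₅ ≢ a₁ → ¬ Z ξ₄ → ¬ Z ξ₅ → a₁ ≢ a₃
    coincident {a₁ = a₁} {a₂} {.a₁} {a₄} {a₅} m a₃≢a₄ a₄≢a₅ a₅≢a₁ ξ₄ ξ₅ refl with a₂ ≟ a₄
    ... | no a₂≢a₄ = isolate (rotate (rotate (rotate m))) (ι a₅) (ι a₁) (ι a₂) (inj₁ refl) (inj₂ (inj₁ refl)) (inj₂ (inj₂ refl)) (inj₂ (inj₁ refl))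
        (ι-≢ a₄≢a₅) (ι-≢ (a₃≢a₄ ∘ sym)) (ι-≢ (a₂≢a₄ ∘ sym)) ξ₄
    ... | yes refl = isolate (rotate (rotate (rotate (rotate m)))) (ι a₁) (ι a₄) (ι a₄) (inj₁ refl) (inj₂ (inj₁ refl)) (inj₁ refl) (inj₂ (inj₁ refl))
        (ι-≢ a₅≢a₁) (ι-≢ (a₄≢a₅ ∘ sym)) (ι-≢ (a₄≢a₅ ∘ sym)) ξ₅

    -- Used with η = ξ * (a - a₁): this weight removes the node a₁ from the moments at the cost of
    -- one equation.
    record Null (η₂ η₃ η₄ η₅ a₂ a₃ a₄ a₅ : ℤ) : Set where
      constructor null
      field
        N₀ : Z (η₂ + η₃ + η₄ + η₅)
        N₁ : Z (a₂ * η₂ + a₃ * η₃ + a₄ * η₄ + a₅ * η₅)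
        N₂ : Z (a₂ * a₂ * η₂ + a₃ * a₃ * η₃ + a₄ * a₄ * η₄ + a₅ * a₅ * η₅)
    open Null

    turn : ∀ {η₂ η₃ η₄ η₅ a₂ a₃ a₄ a₅} → Null η₂ η₃ η₄ η₅ a₂ a₃ a₄ a₅ → Null η₂ η₄ η₅ η₃ a₂ a₄ a₅ a₃
    turn {η₂} {η₃} {η₄} {η₅} {a₂} {a₃} {a₄} {a₅} n = null
      (N₀ n by eq η₂ η₃ η₄ η₅)
      (N₁ n by eq (a₂ * η₂) (a₃ * η₃) (a₄ * η₄) (a₅ * η₅))
      (N₂ n by eq (a₂ * a₂ * η₂) (a₃ * a₃ * η₃) (a₄ * a₄ * η₄) (a₅ * a₅ * η₅))
      where
      eq : ∀ t₂ t₃ t₄ t₅ → t₂ + t₃ + t₄ + t₅ ≡ t₂ + t₄ + t₅ + t₃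
      eq = solve-∀

    P : ℤ → ℤ → ℤ → ℤ → ℤ
    P η η' a a' = η * η' * ((a - a') * (a - a'))

    -- Solving the three equations gives η_i = λ / ∏_{j ≠ i} (a_i - a_j), for which the two terms agree.
    P-complement : ∀ {η₂ η₃ η₄ η₅ a₂ a₃ a₄ a₅} → Null η₂ η₃ η₄ η₅ a₂ a₃ a₄ a₅ →
      Z (P η₂ η₃ a₂ a₃ - P η₄ η₅ a₄ a₅)
    P-complement {η₂} {η₃} {η₄} {η₅} {a₂} {a₃} {a₄} {a₅} n =
      (η₄ * (a₄ - a₃) + η₅ * (a₅ - a₃)) ⊛ (N₁ n ⊖ a₂ ⊛ N₀ n)
      ⊖ (η₄ + η₅) ⊛ (N₂ n ⊖ (a₂ + a₃) ⊛ N₁ n ⊕ (a₂ * a₃) ⊛ N₀ n)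
      ⊖ (η₃ * (a₃ - a₂)) ⊛ (N₁ n ⊖ a₃ ⊛ N₀ n)
      by eq η₂ η₃ η₄ η₅ a₂ a₃ a₄ a₅
      where
      eq : ∀ η₂ η₃ η₄ η₅ a₂ a₃ a₄ a₅ →
        (η₄ * (a₄ - a₃) + η₅ * (a₅ - a₃)) * ((a₂ * η₂ + a₃ * η₃ + a₄ * η₄ + a₅ * η₅) - a₂ * (η₂ + η₃ + η₄ + η₅))
        - (η₄ + η₅) * ((a₂ * a₂ * η₂ + a₃ * a₃ * η₃ + a₄ * a₄ * η₄ + a₅ * a₅ * η₅)
            - (a₂ + a₃) * (a₂ * η₂ + a₃ * η₃ + a₄ * η₄ + a₅ * η₅) + (a₂ * a₃) * (η₂ + η₃ + η₄ + η₅))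
        - (η₃ * (a₃ - a₂)) * ((a₂ * η₂ + a₃ * η₃ + a₄ * η₄ + a₅ * η₅) - a₃ * (η₂ + η₃ + η₄ + η₅))
        ≡ η₂ * η₃ * ((a₂ - a₃) * (a₂ - a₃)) - η₄ * η₅ * ((a₄ - a₅) * (a₄ - a₅))
      eq = solve-∀

    -- This is η₂ times the second moment centred at a₂, in which the term of a₂ itself vanishes.
    P-sum : ∀ {η₂ η₃ η₄ η₅ a₂ a₃ a₄ a₅} → Null η₂ η₃ η₄ η₅ a₂ a₃ a₄ a₅ →
      Z (P η₂ η₃ a₂ a₃ + P η₂ η₄ a₂ a₄ + P η₂ η₅ a₂ a₅)
    P-sum {η₂} {η₃} {η₄} {η₅} {a₂} {a₃} {a₄} {a₅} n =
      η₂ ⊛ (N₂ n ⊖ ((+ 2) * a₂) ⊛ N₁ n ⊕ (a₂ * a₂) ⊛ N₀ n)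
      by eq η₂ η₃ η₄ η₅ a₂ a₃ a₄ a₅
      where
      eq : ∀ η₂ η₃ η₄ η₅ a₂ a₃ a₄ a₅ →
        η₂ * ((a₂ * a₂ * η₂ + a₃ * a₃ * η₃ + a₄ * a₄ * η₄ + a₅ * a₅ * η₅)
          - ((+ 2) * a₂) * (a₂ * η₂ + a₃ * η₃ + a₄ * η₄ + a₅ * η₅) + (a₂ * a₂) * (η₂ + η₃ + η₄ + η₅))
        ≡ η₂ * η₃ * ((a₂ - a₃) * (a₂ - a₃)) + η₂ * η₄ * ((a₂ - a₄) * (a₂ - a₄)) + η₂ * η₅ * ((a₂ - a₅) * (a₂ - a₅))
      eq = solve-∀

    module _ {a₁ a₂ a₃ a₄ a₅ : ℤ} {l₀ l₁ l₂ l₃ l₄ : Line} (cyc : Cycle a₁ a₂ a₃ a₄ a₅ l₀ l₁ l₂ l₃ l₄) where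
      private
        ξ₁ = x l₀ - x l₁
        ξ₂ = x l₁ - x l₂
        ξ₃ = x l₂ - x l₃
        ξ₄ = x l₃ - x l₄
        ξ₅ = x l₄ - x l₀
        d₂ = a₂ - a₁
        d₃ = a₃ - a₁
        d₄ = a₄ - a₁
        d₅ = a₅ - a₁
        η₂ = ξ₂ * d₂
        η₃ = ξ₃ * d₃
        η₄ = ξ₄ * d₄
        η₅ = ξ₅ * d₅

        sq : ℤ → ℤ → ℤ
        sq a b = (a - b) * (a - b)

        q₃ = ξ₂ * sq a₂ a₃
        q₄ = ξ₂ * sq a₂ a₄ + ξ₃ * sq a₃ a₄
        -- The order in `sq a₅ a₃` is the one that `P-complement (turn n)` produces, so that the
        -- final identity can treat the squares as variables.
        q₅ = ξ₂ * sq a₂ a₅ + ξ₃ * sq a₅ a₃ + ξ₄ * sq a₄ a₅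

        s₂ = Δyz (proj₁ (proj₂ cyc))
        s₃ = Δyz (proj₁ (proj₂ (proj₂ cyc)))
        s₄ = Δyz (proj₁ (proj₂ (proj₂ (proj₂ cyc))))
        s₅ = Δyz (proj₂ (proj₂ (proj₂ (proj₂ cyc))))

        n : Null η₂ η₃ η₄ η₅ a₂ a₃ a₄ a₅
        n = null
          (M₁ m ⊖ a₁ ⊛ M₀ m by eq₀ ξ₁ ξ₂ ξ₃ ξ₄ ξ₅ a₁ a₂ a₃ a₄ a₅)
          (M₂ m ⊖ a₁ ⊛ M₁ m by eq₁ ξ₁ ξ₂ ξ₃ ξ₄ ξ₅ a₁ a₂ a₃ a₄ a₅)
          (M₃ m ⊖ a₁ ⊛ M₂ m by eq₂ ξ₁ ξ₂ ξ₃ ξ₄ ξ₅ a₁ a₂ a₃ a₄ a₅)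
          where
          m = cycle-moments cyc

          eq₀ : ∀ ξ₁ ξ₂ ξ₃ ξ₄ ξ₅ a₁ a₂ a₃ a₄ a₅ →
            (a₁ * ξ₁ + a₂ * ξ₂ + a₃ * ξ₃ + a₄ * ξ₄ + a₅ * ξ₅) - a₁ * (ξ₁ + ξ₂ + ξ₃ + ξ₄ + ξ₅)
            ≡ ξ₂ * (a₂ - a₁) + ξ₃ * (a₃ - a₁) + ξ₄ * (a₄ - a₁) + ξ₅ * (a₅ - a₁)
          eq₀ = solve-∀

          eq₁ : ∀ ξ₁ ξ₂ ξ₃ ξ₄ ξ₅ a₁ a₂ a₃ a₄ a₅ →
            (a₁ * a₁ * ξ₁ + a₂ * a₂ * ξ₂ + a₃ * a₃ * ξ₃ + a₄ * a₄ * ξ₄ + a₅ * a₅ * ξ₅)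
            - a₁ * (a₁ * ξ₁ + a₂ * ξ₂ + a₃ * ξ₃ + a₄ * ξ₄ + a₅ * ξ₅)
            ≡ a₂ * (ξ₂ * (a₂ - a₁)) + a₃ * (ξ₃ * (a₃ - a₁)) + a₄ * (ξ₄ * (a₄ - a₁)) + a₅ * (ξ₅ * (a₅ - a₁))
          eq₁ = solve-∀

          eq₂ : ∀ ξ₁ ξ₂ ξ₃ ξ₄ ξ₅ a₁ a₂ a₃ a₄ a₅ →
            (a₁ * a₁ * a₁ * ξ₁ + a₂ * a₂ * a₂ * ξ₂ + a₃ * a₃ * a₃ * ξ₃ + a₄ * a₄ * a₄ * ξ₄ + a₅ * a₅ * a₅ * ξ₅)
            - a₁ * (a₁ * a₁ * ξ₁ + a₂ * a₂ * ξ₂ + a₃ * a₃ * ξ₃ + a₄ * a₄ * ξ₄ + a₅ * a₅ * ξ₅)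
            ≡ a₂ * a₂ * (ξ₂ * (a₂ - a₁)) + a₃ * a₃ * (ξ₃ * (a₃ - a₁)) + a₄ * a₄ * (ξ₄ * (a₄ - a₁)) + a₅ * a₅ * (ξ₅ * (a₅ - a₁))
          eq₂ = solve-∀

        -- For the fixed line l₁, `G a l₁` is a quadratic polynomial in a, which the three equations
        -- of `n` annihilate.
        ΣηG : Z (η₂ * G a₂ l₁ + η₃ * G a₃ l₁ + η₄ * G a₄ l₁ + η₅ * G a₅ l₁)
        ΣηG = x l₁ ⊛ N₂ n ⊖ ((+ 2) * y l₁) ⊛ N₁ n ⊕ z l₁ ⊛ N₀ n
          by eq η₂ η₃ η₄ η₅ a₂ a₃ a₄ a₅ (x l₁) (y l₁) (z l₁)
          where
          eq : ∀ η₂ η₃ η₄ η₅ a₂ a₃ a₄ a₅ x y z →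
            x * (a₂ * a₂ * η₂ + a₃ * a₃ * η₃ + a₄ * a₄ * η₄ + a₅ * a₅ * η₅)
            - ((+ 2) * y) * (a₂ * η₂ + a₃ * η₃ + a₄ * η₄ + a₅ * η₅) + z * (η₂ + η₃ + η₄ + η₅)
            ≡ η₂ * (a₂ * a₂ * x - (+ 2) * a₂ * y + z) + η₃ * (a₃ * a₃ * x - (+ 2) * a₃ * y + z)
              + η₄ * (a₄ * a₄ * x - (+ 2) * a₄ * y + z) + η₅ * (a₅ * a₅ * x - (+ 2) * a₅ * y + z)
          eq = solve-∀

        r₂ : Z (G a₂ l₁ - G a₂ l₂)
        r₂ = G-step a₂ s₂ by eq (G a₂ l₁) (G a₂ l₂) ξ₂ a₂
          where
          eq : ∀ g g' ξ a → (g - g') - ξ * ((a - a) * (a - a)) ≡ g - g'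
          eq = solve-∀

        r₃ : Z ((G a₃ l₁ - G a₃ l₃) - q₃)
        r₃ = G-step a₃ s₂ ⊕ G-step a₃ s₃ by eq (G a₃ l₁) (G a₃ l₂) (G a₃ l₃) ξ₂ ξ₃ a₂ a₃
          where
          eq : ∀ g₁ g₂ g₃ ξ₂ ξ₃ a₂ a₃ →
            ((g₁ - g₂) - ξ₂ * ((a₃ - a₂) * (a₃ - a₂))) + ((g₂ - g₃) - ξ₃ * ((a₃ - a₃) * (a₃ - a₃)))
            ≡ (g₁ - g₃) - ξ₂ * ((a₂ - a₃) * (a₂ - a₃))
          eq = solve-∀

        r₄ : Z ((G a₄ l₁ - G a₄ l₄) - q₄)
        r₄ = G-step a₄ s₂ ⊕ G-step a₄ s₃ ⊕ G-step a₄ s₄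
          by eq (G a₄ l₁) (G a₄ l₂) (G a₄ l₃) (G a₄ l₄) ξ₂ ξ₃ ξ₄ a₂ a₃ a₄
          where
          eq : ∀ g₁ g₂ g₃ g₄ ξ₂ ξ₃ ξ₄ a₂ a₃ a₄ →
            ((g₁ - g₂) - ξ₂ * ((a₄ - a₂) * (a₄ - a₂))) + ((g₂ - g₃) - ξ₃ * ((a₄ - a₃) * (a₄ - a₃)))
            + ((g₃ - g₄) - ξ₄ * ((a₄ - a₄) * (a₄ - a₄)))
            ≡ (g₁ - g₄) - (ξ₂ * ((a₂ - a₄) * (a₂ - a₄)) + ξ₃ * ((a₃ - a₄) * (a₃ - a₄)))
          eq = solve-∀

        r₅ : Z ((G a₅ l₁ - G a₅ l₀) - q₅)
        r₅ = G-step a₅ s₂ ⊕ G-step a₅ s₃ ⊕ G-step a₅ s₄ ⊕ G-step a₅ s₅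
          by eq (G a₅ l₁) (G a₅ l₂) (G a₅ l₃) (G a₅ l₄) (G a₅ l₀) ξ₂ ξ₃ ξ₄ ξ₅ a₂ a₃ a₄ a₅
          where
          eq : ∀ g₁ g₂ g₃ g₄ g₀ ξ₂ ξ₃ ξ₄ ξ₅ a₂ a₃ a₄ a₅ →
            ((g₁ - g₂) - ξ₂ * ((a₅ - a₂) * (a₅ - a₂))) + ((g₂ - g₃) - ξ₃ * ((a₅ - a₃) * (a₅ - a₃)))
            + ((g₃ - g₄) - ξ₄ * ((a₅ - a₄) * (a₅ - a₄))) + ((g₄ - g₀) - ξ₅ * ((a₅ - a₅) * (a₅ - a₅)))
            ≡ (g₁ - g₀) - (ξ₂ * ((a₂ - a₅) * (a₂ - a₅)) + ξ₃ * ((a₅ - a₃) * (a₅ - a₃)) + ξ₄ * ((a₄ - a₅) * (a₄ - a₅)))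
          eq = solve-∀

        -- In `weighted cyc a₁` each `G` is taken at the line where its step ends, in `ΣηG` always
        -- at l₁. Subtracting leaves a quadratic relation between the ξ alone, the one that the
        -- linear moments lack.
        H : Z (η₃ * q₃ + η₄ * q₄ + η₅ * q₅)
        H = ΣηG ⊖ weighted cyc a₁ ⊖ η₂ ⊛ r₂ ⊖ η₃ ⊛ r₃ ⊖ η₄ ⊛ r₄ ⊖ η₅ ⊛ r₅
          by eq η₂ η₃ η₄ η₅ (G a₂ l₁) (G a₃ l₁) (G a₄ l₁) (G a₅ l₁) (G a₂ l₂) (G a₃ l₃) (G a₄ l₄) (G a₅ l₀)
                q₃ q₄ q₅ ξ₁ a₁ (G a₁ l₁)
          where
          eq : ∀ η₂ η₃ η₄ η₅ h₂ h₃ h₄ h₅ g₂ g₃ g₄ g₅ q₃ q₄ q₅ ξ₁ a₁ g₁ →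
            (η₂ * h₂ + η₃ * h₃ + η₄ * h₄ + η₅ * h₅)
            - (ξ₁ * (a₁ - a₁) * g₁ + η₂ * g₂ + η₃ * g₃ + η₄ * g₄ + η₅ * g₅)
            - η₂ * (h₂ - g₂) - η₃ * ((h₃ - g₃) - q₃) - η₄ * ((h₄ - g₄) - q₄) - η₅ * ((h₅ - g₅) - q₅)
            ≡ η₃ * q₃ + η₄ * q₄ + η₅ * q₅
          eq = solve-∀

      -- With A, B, C the common values of P on the pairs 23|45, 24|35, 25|34 (so A + B + C = 0), multiplying H by
      -- d₂ d₃ d₄ gives d₃ d₄ (A + B + C) + d₂ d₄ (B + C) + d₂ d₃ A = d₂ (d₃ - d₄) A.
      five-cycle-product : Z (d₂ * (a₃ - a₄) * P η₂ η₃ a₂ a₃)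
      five-cycle-product =
        (d₂ * d₃ * d₄) ⊛ H ⊖ (d₃ * d₄) ⊛ P-sum n ⊕ (d₂ * d₃) ⊛ P-complement n
        ⊖ (d₂ * d₄) ⊛ (P-sum n ⊖ P-complement (turn (turn n)) ⊖ P-complement (turn n))
        by trans (eq ξ₂ ξ₃ ξ₄ ξ₅ d₂ d₃ d₄ d₅ (sq a₂ a₃) (sq a₂ a₄) (sq a₂ a₅) (sq a₃ a₄) (sq a₅ a₃) (sq a₄ a₅))
             (cong (λ e → d₂ * e * P η₂ η₃ a₂ a₃) (eq' a₁ a₃ a₄))
        where
        eq : ∀ ξ₂ ξ₃ ξ₄ ξ₅ d₂ d₃ d₄ d₅ s₂₃ s₂₄ s₂₅ s₃₄ s₅₃ s₄₅ →
          (d₂ * d₃ * d₄) * ((ξ₃ * d₃) * (ξ₂ * s₂₃) + (ξ₄ * d₄) * (ξ₂ * s₂₄ + ξ₃ * s₃₄)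
              + (ξ₅ * d₅) * (ξ₂ * s₂₅ + ξ₃ * s₅₃ + ξ₄ * s₄₅))
          - (d₃ * d₄) * ((ξ₂ * d₂) * (ξ₃ * d₃) * s₂₃ + (ξ₂ * d₂) * (ξ₄ * d₄) * s₂₄ + (ξ₂ * d₂) * (ξ₅ * d₅) * s₂₅)
          + (d₂ * d₃) * ((ξ₂ * d₂) * (ξ₃ * d₃) * s₂₃ - (ξ₄ * d₄) * (ξ₅ * d₅) * s₄₅)
          - (d₂ * d₄) * (((ξ₂ * d₂) * (ξ₃ * d₃) * s₂₃ + (ξ₂ * d₂) * (ξ₄ * d₄) * s₂₄ + (ξ₂ * d₂) * (ξ₅ * d₅) * s₂₅)
              - ((ξ₂ * d₂) * (ξ₅ * d₅) * s₂₅ - (ξ₃ * d₃) * (ξ₄ * d₄) * s₃₄)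
              - ((ξ₂ * d₂) * (ξ₄ * d₄) * s₂₄ - (ξ₅ * d₅) * (ξ₃ * d₃) * s₅₃))
          ≡ d₂ * (d₃ - d₄) * ((ξ₂ * d₂) * (ξ₃ * d₃) * s₂₃)
        eq = solve-∀

        eq' : ∀ a₁ a₃ a₄ → (a₃ - a₁) - (a₄ - a₁) ≡ a₃ - a₄
        eq' = solve-∀

    -- Every factor of `five-cycle-product` is nonzero. The only one that is not given by
    -- consecutive nodes or lines is a₃ - a₁, which `coincident` provides.
    no-5-cycle : ∀ {a₁ a₂ a₃ a₄ a₅ l₀ l₁ l₂ l₃ l₄} →
      Cycle (ι a₁) (ι a₂) (ι a₃) (ι a₄) (ι a₅) l₀ l₁ l₂ l₃ l₄ →
      a₁ ≢ a₂ → a₂ ≢ a₃ → a₃ ≢ a₄ → a₄ ≢ a₅ → a₅ ≢ a₁ →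
      ¬ Z (x l₁ - x l₂) → ¬ Z (x l₂ - x l₃) → ¬ Z (x l₃ - x l₄) → ¬ Z (x l₄ - x l₀) → ⊥
    no-5-cycle cyc a₁≢a₂ a₂≢a₃ a₃≢a₄ a₄≢a₅ a₅≢a₁ ξ₂ ξ₃ ξ₄ ξ₅ =
      Z-prime (five-cycle-product cyc) (nz* (ι-≢ (a₁≢a₂ ∘ sym)) (ι-≢ a₃≢a₄))
        (nz* (nz* (nz* ξ₂ (ι-≢ (a₁≢a₂ ∘ sym))) (nz* ξ₃ (ι-≢ (a₁≢a₃ ∘ sym)))) (nz* (ι-≢ a₂≢a₃) (ι-≢ a₂≢a₃)))
      where
      a₁≢a₃ = coincident (cycle-moments cyc) a₃≢a₄ a₄≢a₅ a₅≢a₁ ξ₄ ξ₅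

-- Coloured regular bipartite graphs and walks as words.

module Colourings where

  open import Data.Bool as Bool using (Bool; true; false; not; if_then_else_)
  open import Data.Bool.Properties using (not-¬; not-involutive)
  open import Data.Empty using (⊥)
  open import Data.Fin as Fin using (Fin; fromℕ<)
  import Data.Fin.Properties as Fin
  open import Data.Integer using (ℤ; +_; -_; _+_; _-_; _*_; 0ℤ)
  open import Data.Integer.DivMod using (_%ℕ_; _/ℕ_; n%ℕd<d; a≡a%ℕn+[a/ℕn]*n)
  open import Data.Integer.Divisibility.Signed using (divides)
  open import Data.Integer.Tactic.RingSolver using (solve-∀)
  open import Data.Nat as ℕ using (ℕ; suc)
  import Data.Nat.Properties as ℕ
  open import Data.Nat.Primality using (Prime; prime⇒nonZero)
  open import Data.Product using (_×_; _,_; proj₁; proj₂)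
  open import Data.Product.Properties using (≡-dec)
  open import Data.Vec using (Vec; []; _∷_; _∷ʳ_; head; tail; last; initLast)
  open import Data.Product.Function.NonDependent.Propositional using (_×-↔_)
  open import Function using (_∘_; _↔_)
  open import Function.Properties.Inverse using (↔-refl; ↔-trans)
  open import Relation.Binary.Definitions using (DecidableEquality)
  open import Relation.Binary.PropositionalEquality using (_≡_; _≢_; refl; sym; trans; cong; cong₂; subst; subst₂)
  open import Relation.Nullary using (Dec; yes; no; contradiction)
  open Cycles

  𝟙 : ∀ {P : Set} → Dec P → ℕ
  𝟙 (yes _) = 1
  𝟙 (no _)  = 0

  -- Every vertex has exactly one neighbour `ν x v` of each colour x, so a walk is its start and a
  -- list of colours. In the graphs below the colour is the first coordinate of a point or line.
  record Coloured (q : ℕ) : Set₁ where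
    field
      V      : Set
      size   : ℕ
      enum   : Fin size ↔ V
      _≟_    : DecidableEquality V
      side   : V → Bool
      col    : V → Fin q
      ν      : Fin q → V → V
      side-ν : ∀ x v → side (ν x v) ≡ not (side v)
      col-ν  : ∀ x v → col (ν x v) ≡ x
      ν-back : ∀ x v → ν (col v) (ν x v) ≡ v

    ν-≢ : ∀ x v → ν x v ≢ v
    ν-≢ x v eq = not-¬ refl (trans (sym (cong side eq)) (side-ν x v))

  module Words {q} (S : Coloured q) where
    open Coloured S

    -- A word lists the colours of a walk, the last step first.
    act : ∀ {n} → V → Vec (Fin q) n → V
    act r []      = r
    act r (x ∷ w) = ν x (act r w)

    -- The number of backtracking steps: after the step y from `act r w`, the colour x leads back
    -- exactly when it is the colour of `act r w`.
    bad : ∀ {n} → V → Vec (Fin q) n → ℕ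
    bad r []          = 0
    bad r (x ∷ [])    = 0
    bad r (x ∷ y ∷ w) = 𝟙 (x Fin.≟ col (act r w)) ℕ.+ bad r (y ∷ w)

    Unique : ℕ → Set
    Unique n = ∀ r (w w' : Vec (Fin q) n) → bad r w ≡ 0 → bad r w' ≡ 0 → act r w ≡ act r w' → w ≡ w'

    -- Two walks that differ in their first and in their last edges close up to a cycle.
    NoCycle : ℕ → Set
    NoCycle n = ∀ r (w w' : Vec (Fin q) (suc (suc n))) → bad r w ≡ 0 → bad r w' ≡ 0 → act r w ≡ act r w' →
      head (tail w) ≢ head (tail w') → last w ≢ last w' → ⊥

    bad⇒≢ : ∀ {n} r x y (w : Vec (Fin q) n) → bad r (x ∷ y ∷ w) ≡ 0 → x ≢ col (act r w)
    bad⇒≢ r x y w h with x Fin.≟ col (act r w)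
    ... | no ≢ = ≢

    bad-tail : ∀ {n} r x (w : Vec (Fin q) n) → bad r (x ∷ w) ≡ 0 → bad r w ≡ 0
    bad-tail r x []      h = refl
    bad-tail r x (y ∷ w) h = ℕ.m+n≡0⇒n≡0 (𝟙 (x Fin.≟ col (act r w))) h

    act-∷ʳ : ∀ {n} r (w : Vec (Fin q) n) x → act r (w ∷ʳ x) ≡ act (ν x r) w
    act-∷ʳ r []      x = refl
    act-∷ʳ r (y ∷ w) x = cong (ν y) (act-∷ʳ r w x)

    bad-∷ʳ : ∀ {n} r (w : Vec (Fin q) n) x → bad r (w ∷ʳ x) ≡ 0 → bad (ν x r) w ≡ 0
    bad-∷ʳ r []          x h = refl
    bad-∷ʳ r (y ∷ [])    x h = refl
    bad-∷ʳ r (y ∷ z ∷ w) x h =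
      cong₂ ℕ._+_ (trans (cong (λ u → 𝟙 (y Fin.≟ col u)) (sym (act-∷ʳ r w x))) (ℕ.m+n≡0⇒m≡0 _ h))
                  (bad-∷ʳ r (z ∷ w) x (bad-tail r y (z ∷ (w ∷ʳ x)) h))

    head-≡ : ∀ {u v x y} → ν x u ≡ ν y v → x ≡ y
    head-≡ {u} {v} {x} {y} eq = trans (sym (col-ν x u)) (trans (cong col eq) (col-ν y v))

    ν-cancel : ∀ {u v x y} → ν x u ≡ ν y v → col u ≡ col v → u ≡ v
    ν-cancel {u} {v} {x} {y} eq c = trans (sym (ν-back x u)) (trans (cong₂ ν c eq) (ν-back y v))

    unique₀ : Unique 0
    unique₀ r [] [] _ _ _ = refl

    unique₁ : Unique 1
    unique₁ r (x ∷ []) (y ∷ []) _ _ eq = cong (_∷ []) (head-≡ eq)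

    -- The second letter is the colour of the last vertex but one, which together with the common
    -- end determines that vertex. So equal second letters mean equal last edges, and a common edge
    -- at either end can be removed.
    unique-step : ∀ {n} → Unique (suc n) → NoCycle n → Unique (suc (suc n))
    unique-step {n} U noCycle r (x ∷ y ∷ v) (x' ∷ y' ∷ v') h h' eq with y Fin.≟ y' | last (x ∷ y ∷ v) Fin.≟ last (x' ∷ y' ∷ v')
    ... | yes y≡y' | _ = cong₂ _∷_ (head-≡ eq)
          (U r (y ∷ v) (y' ∷ v') (bad-tail r x (y ∷ v) h) (bad-tail r x' (y' ∷ v') h')
            (ν-cancel eq (trans (col-ν y _) (trans y≡y' (sym (col-ν y' _))))))
    ... | no y≢y' | no f≢f' = contradiction (noCycle r _ _ h h' eq y≢y' f≢f') λ ()
    ... | no y≢y' | yes f≡f' = strip (x ∷ y ∷ v) (x' ∷ y' ∷ v') h h' eq f≡f'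
      where
      strip : ∀ (w w' : Vec (Fin q) (suc (suc n))) → bad r w ≡ 0 → bad r w' ≡ 0 → act r w ≡ act r w' → last w ≡ last w' → w ≡ w'
      strip w w' h h' eq f≡f' with initLast w | initLast w'
      strip _ _ h h' eq refl | i , f , refl | i' , _ , refl =
        cong (_∷ʳ f) (U (ν f r) i i' (bad-∷ʳ r i f h) (bad-∷ʳ r i' f h')
          (trans (sym (act-∷ʳ r i f)) (trans eq (act-∷ʳ r i' f))))

    side-flip : ∀ {b} x v → side v ≡ b → side (ν x v) ≡ not b
    side-flip x v s = trans (side-ν x v) (cong not s)

    -- Points are the vertices with side true, lines those with side false.
    Inc : V → V → Set
    Inc u l = side u ≡ true × ν (col l) u ≡ l

    inc-ν : ∀ x u → side u ≡ true → Inc u (ν x u)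
    inc-ν x u s = s , cong (λ y → ν y u) (col-ν x u)

    ν-inc : ∀ a l → side l ≡ false → Inc (ν a l) l
    ν-inc a l s = side-flip a l s , ν-back a l

  -- The affine quadrangle and hexagon, built one coordinate at a time.

  module Tower (p : ℕ) (prime : Prime p) where
    open Modular p prime
    open Coloured

    private instance
      p≢0 : ℕ.NonZero p
      p≢0 = prime⇒nonZero prime

    red : ℤ → Fin p
    red i = fromℕ< (n%ℕd<d i p)

    red-Z : ∀ i → Z (ι (red i) - i)
    red-Z i = divides (- (i /ℕ p)) (trans (cong₂ _-_ (cong +_ (Fin.toℕ-fromℕ< (n%ℕd<d i p))) (a≡a%ℕn+[a/ℕn]*n i p))
      (eq (+ (i %ℕ p)) (i /ℕ p) (+ p)))
      where
      eq : ∀ r d k → r - (r + d * k) ≡ - d * k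
      eq = solve-∀

    _⊝_ : ℤ → Fin p → Fin p
    i ⊝ e = red (i - ι e)

    ⊝-Z : ∀ i e → Z ((ι e + ι (i ⊝ e)) - i)
    ⊝-Z i e = red-Z (i - ι e) by eq i (ι e) (ι (i ⊝ e))
      where
      eq : ∀ i e d → d - (i - e) ≡ (e + d) - i
      eq = solve-∀

    ⊝-involutive : ∀ i e → i ⊝ (i ⊝ e) ≡ e
    ⊝-involutive i e = ι-injective ((⊝-Z i (i ⊝ e) ⊖ ⊝-Z i e) by eq i (ι e) (ι (i ⊝ e)) (ι (i ⊝ (i ⊝ e))))
      where
      eq : ∀ i e d c → ((d + c) - i) - ((e + d) - i) ≡ c - e
      eq = solve-∀

    complete : Coloured p
    complete = record
      { V      = Bool × Fin p
      ; size   = 2 ℕ.* p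
      ; enum   = ↔-trans Fin.*↔× (Fin.2↔Bool ×-↔ ↔-refl)
      ; _≟_    = ≡-dec Bool._≟_ Fin._≟_
      ; side   = proj₁
      ; col    = proj₂
      ; ν      = λ x v → not (proj₁ v) , x
      ; side-ν = λ _ _ → refl
      ; col-ν  = λ _ _ → refl
      ; ν-back = λ x v → cong (_, proj₂ v) (not-involutive (proj₁ v))
      }

    module Extension (S : Coloured p) (f : V S → V S → ℤ) where

      φ : V S → V S → ℤ
      φ u v = if side S u then f u v else f v u

      φ-sym : ∀ x v → φ (ν S x v) v ≡ φ v (ν S x v)
      φ-sym x v rewrite side-ν S x v with side S v
      ... | true  = refl
      ... | false = refl

      -- New coordinates e and e' of a point and a line on an edge satisfy e + e' = f.
      extend : Coloured p
      extend = record
        { V      = V S × Fin p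
        ; size   = size S ℕ.* p
        ; enum   = ↔-trans Fin.*↔× (enum S ×-↔ ↔-refl)
        ; _≟_    = ≡-dec (_≟_ S) Fin._≟_
        ; side   = side S ∘ proj₁
        ; col    = col S ∘ proj₁
        ; ν      = λ x v → ν S x (proj₁ v) , φ (proj₁ v) (ν S x (proj₁ v)) ⊝ proj₂ v
        ; side-ν = λ x v → side-ν S x (proj₁ v)
        ; col-ν  = λ x v → col-ν S x (proj₁ v)
        ; ν-back = back
        }
        where
        back : ∀ x v → _
        back x (v , e) rewrite ν-back S x v | φ-sym x v = cong (v ,_) (⊝-involutive (φ v (ν S x v)) e)

      edge : ∀ x v → side S (proj₁ v) ≡ true → Z ((ι (proj₂ v) + ι (proj₂ (ν extend x v))) - f (proj₁ v) (ν S x (proj₁ v)))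
      edge x (v , e) s = subst (λ b → Z ((ι e + ι (proj₂ (ν extend x (v , e)))) - (if b then f v (ν S x v) else f (ν S x v) v))) s
        (⊝-Z (φ v (ν S x v)) e)

      private
        module W  = Words S
        module W' = Words extend

      proj-act : ∀ {n} r (w : Vec (Fin p) n) → proj₁ (W'.act r w) ≡ W.act (proj₁ r) w
      proj-act r []      = refl
      proj-act r (x ∷ w) = cong (ν S x) (proj-act r w)

      proj-bad : ∀ {n} r (w : Vec (Fin p) n) → W'.bad r w ≡ W.bad (proj₁ r) w
      proj-bad r []          = refl
      proj-bad r (x ∷ [])    = refl
      proj-bad r (x ∷ y ∷ w) = cong₂ ℕ._+_ (cong (λ u → 𝟙 (x Fin.≟ col S u)) (proj-act r w)) (proj-bad r (y ∷ w))

      -- The extension covers `S`: the projection keeps the word of a walk and its backtracking, so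
      -- coinciding ends upstairs coincide downstairs.
      extend-unique : ∀ {n} → W.Unique n → W'.Unique n
      extend-unique U r w w' h h' eq = U (proj₁ r) w w'
        (trans (sym (proj-bad r w)) h) (trans (sym (proj-bad r w')) h')
        (trans (sym (proj-act r w)) (trans (cong proj₁ eq) (proj-act r w')))

    -- A point (p₁, …, p₅) and a line [l₁, …, l₅] are adjacent iff p₂ + l₂ = p₁ l₁, p₃ + l₃ = p₁ l₂, p₄ + l₄ = p₁ l₃ and
    -- p₅ + l₅ = p₂ l₃ - p₃ l₂. The first two equations give the affine part of a generalized quadrangle, all four that of
    -- a generalized hexagon.
    S₁ : Coloured p
    S₁ = complete

    f₂ : V S₁ → V S₁ → ℤ
    f₂ u l = ι (col S₁ u) * ι (col S₁ l)
    module E₂ = Extension S₁ f₂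

    S₂ : Coloured p
    S₂ = E₂.extend

    f₃ : V S₂ → V S₂ → ℤ
    f₃ u l = ι (col S₂ u) * ι (proj₂ l)
    module E₃ = Extension S₂ f₃

    S₃ : Coloured p
    S₃ = E₃.extend

    f₄ : V S₃ → V S₃ → ℤ
    f₄ u l = ι (col S₃ u) * ι (proj₂ l)
    module E₄ = Extension S₃ f₄

    S₄ : Coloured p
    S₄ = E₄.extend

    f₅ : V S₄ → V S₄ → ℤ
    f₅ ((((_ , _) , b) , c) , _) ((((_ , _) , y) , z) , _) = ι b * ι z - ι c * ι y
    module E₅ = Extension S₄ f₅

    S₅ : Coloured p
    S₅ = E₅.extend

    module _ where
      open Words S₃

      L₃ : V S₃ → Line
      L₃ (((_ , x) , y) , z) = line (ι x) (ι y) (ι z) 0ℤ 0ℤ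

      step₃-ν : ∀ x x' u → side S₃ u ≡ true → Step₃ (ι (col S₃ u)) (L₃ (ν S₃ x u)) (L₃ (ν S₃ x' u))
      step₃-ν x x' u@(((_ , a) , b) , c) s = step₃ Δy (Δz ⊕ ι a ⊛ Δy by eq₂ (ι a) (ι x) (ι x') (ι y) (ι y') (ι z) (ι z'))
        where
        l₂ = ν S₂ x (proj₁ u)
        l₂' = ν S₂ x' (proj₁ u)
        y = proj₂ l₂
        y' = proj₂ l₂'
        z = proj₂ (ν S₃ x u)
        z' = proj₂ (ν S₃ x' u)

        eq₁ : ∀ a b x x' y y' → ((b + y) - a * x) - ((b + y') - a * x') ≡ (y - y') - a * (x - x')
        eq₁ = solve-∀

        eq₂ : ∀ a x x' y y' z z' → ((z - z') - a * (y - y')) + a * ((y - y') - a * (x - x')) ≡ (z - z') - a * a * (x - x')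
        eq₂ = solve-∀

        Δy : Z ((ι y - ι y') - ι a * (ι x - ι x'))
        Δy = E₂.edge x (proj₁ u) s ⊖ E₂.edge x' (proj₁ u) s by eq₁ (ι a) (ι b) (ι x) (ι x') (ι y) (ι y')

        Δz : Z ((ι z - ι z') - ι a * (ι y - ι y'))
        Δz = E₃.edge x u s ⊖ E₃.edge x' u s by eq₁ (ι a) (ι c) (ι y) (ι y') (ι z) (ι z')

      step₃-inc : ∀ {u l l'} → Inc u l → Inc u l' → Step₃ (ι (col S₃ u)) (L₃ l) (L₃ l')
      step₃-inc {u} {l} {l'} (s , e) (_ , e') =
        subst₂ (λ l l' → Step₃ (ι (col S₃ u)) (L₃ l) (L₃ l')) e e' (step₃-ν (col S₃ l) (col S₃ l') u s)

      -- The two walks close up to a cycle alternating between points and lines; `go` reads off its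
      -- lines in order, according to whether r is a point or a line. Two neighbours of one vertex
      -- that differ have different colours, and this turns the absence of backtracking into the
      -- required inequalities. The longer cycles below are treated alike.
      noCycle₃-2 : NoCycle 0
      noCycle₃-2 r (x₂ ∷ x₁ ∷ []) (y₂ ∷ y₁ ∷ []) h₂ g₂ e x₁≢y₁ _ = go (side S₃ r) refl
        where
        u₁ = ν S₃ x₁ r
        v₁ = ν S₃ y₁ r
        x₂≢r = bad⇒≢ r x₂ x₁ ([]) h₂

        go : ∀ b → side S₃ r ≡ b → ⊥
        go true s₀ = no-2-cycle
          (step₃-inc (ν-inc x₂ u₁ s₁) (subst (λ u → Inc u v₁) (sym e) (ν-inc y₂ v₁ t₁)))
          (step₃-inc (inc-ν y₁ r s₀) (inc-ν x₁ r s₀))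
          (ι-≢ x₂≢r) (ι-≢ x₁≢y₁)
          where
          s₁ = side-flip x₁ r s₀
          t₁ = side-flip y₁ r s₀
        go false s₀ = no-2-cycle
          (step₃-inc (ν-inc x₁ r s₀) (inc-ν x₂ u₁ s₁))
          (step₃-inc (subst (Inc v₁) (sym e) (inc-ν y₂ v₁ t₁)) (ν-inc y₁ r s₀))
          (ι-≢ x₁≢y₁) (ι-≢ (x₂≢r ∘ sym))
          where
          s₁ = side-flip x₁ r s₀
          t₁ = side-flip y₁ r s₀

      noCycle₃-3 : NoCycle 1
      noCycle₃-3 r (x₃ ∷ x₂ ∷ x₁ ∷ []) (y₃ ∷ y₂ ∷ y₁ ∷ []) h₃ g₃ e x₂≢y₂ x₁≢y₁ = go (side S₃ r) refl
        where
        u₁ = ν S₃ x₁ r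
        u₂ = ν S₃ x₂ u₁
        v₁ = ν S₃ y₁ r
        v₂ = ν S₃ y₂ v₁
        h₂ = bad-tail r x₃ (x₂ ∷ x₁ ∷ []) h₃
        x₂≢r = bad⇒≢ r x₂ x₁ ([]) h₂
        x₃≢x₁ = bad⇒≢ r x₃ x₂ (x₁ ∷ []) h₃

        go : ∀ b → side S₃ r ≡ b → ⊥
        go true s₀ = no-3-cycle
          (step₃-inc (ν-inc x₂ u₁ s₁) (inc-ν x₃ u₂ s₂))
          (step₃-inc (subst (Inc v₂) (sym e) (inc-ν y₃ v₂ t₂)) (ν-inc y₂ v₁ t₁))
          (step₃-inc (inc-ν y₁ r s₀) (inc-ν x₁ r s₀))
          (ι-≢ x₂≢y₂) (ι-≢ x₂≢r) (ι-≢ (x₃≢x₁ ∘ sym))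
          where
          s₁ = side-flip x₁ r s₀
          s₂ = side-flip x₂ u₁ s₁
          t₁ = side-flip y₁ r s₀
          t₂ = side-flip y₂ v₁ t₁
        go false s₀ = no-3-cycle
          (step₃-inc (ν-inc x₁ r s₀) (inc-ν x₂ u₁ s₁))
          (step₃-inc (ν-inc x₃ u₂ s₂) (subst (λ u → Inc u v₂) (sym e) (ν-inc y₃ v₂ t₂)))
          (step₃-inc (inc-ν y₂ v₁ t₁) (ν-inc y₁ r s₀))
          (ι-≢ (x₃≢x₁ ∘ sym)) (ι-≢ x₁≢y₁) (ι-≢ (x₂≢r ∘ sym))
          where
          s₁ = side-flip x₁ r s₀
          s₂ = side-flip x₂ u₁ s₁
          t₁ = side-flip y₁ r s₀
          t₂ = side-flip y₂ v₁ t₁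

      S₃-unique : ∀ {n} → n ℕ.≤ 3 → Unique n
      S₃-unique {0} _ = unique₀
      S₃-unique {1} _ = unique₁
      S₃-unique {2} _ = unique-step unique₁ noCycle₃-2
      S₃-unique {3} _ = unique-step (S₃-unique (ℕ.m≤m+n 2 1)) noCycle₃-3
      S₃-unique {suc (suc (suc (suc _)))} (ℕ.s≤s (ℕ.s≤s (ℕ.s≤s ())))

    module _ where
      open Words S₅

      L₅ : V S₅ → Line
      L₅ (((((_ , x) , y) , z) , u) , v) = line (ι x) (ι y) (ι z) (ι u) (ι v)

      -- Subtracting the equations of the two lines leaves the coordinates b and c of the point in
      -- the last one. Substituting b = a x' - y' and c = a y' - z', the incidences with the second
      -- line, produces the factor `G a l'`.
      step₅-ν : ∀ x x' u → side S₅ u ≡ true → Step₅ (ι (col S₅ u)) (L₅ (ν S₅ x u)) (L₅ (ν S₅ x' u))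
      step₅-ν x x' r@(((((_ , a) , b) , c) , d) , f) s = step₅ (step₃ Δy Δz)
        (Δu' ⊕ ι a ⊛ Δz by eq₂ (ι a) (ι x) (ι x') (ι z) (ι z') (ι u) (ι u'))
        (Δv' ⊕ ι b ⊛ Δz ⊖ ι c ⊛ Δy ⊕ ((ι x - ι x') * ι a * ι a) ⊛ E₂.edge x' (proj₁ (proj₁ (proj₁ r))) s
             ⊖ ((ι x - ι x') * ι a) ⊛ E₃.edge x' (proj₁ (proj₁ r)) s
         by eq₃ (ι a) (ι b) (ι c) (ι x) (ι x') (ι y) (ι y') (ι z) (ι z') (ι v) (ι v'))
        where
        open Step₃ (step₃-ν x x' (proj₁ (proj₁ r)) s)
        l = ν S₅ x r
        l' = ν S₅ x' r
        y = proj₂ (proj₁ (proj₁ (proj₁ l)))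
        y' = proj₂ (proj₁ (proj₁ (proj₁ l')))
        z = proj₂ (proj₁ (proj₁ l))
        z' = proj₂ (proj₁ (proj₁ l'))
        u = proj₂ (proj₁ l)
        u' = proj₂ (proj₁ l')
        v = proj₂ l
        v' = proj₂ l'

        eq₁ : ∀ a d z z' u u' → ((d + u) - a * z) - ((d + u') - a * z') ≡ (u - u') - a * (z - z')
        eq₁ = solve-∀

        eq₂ : ∀ a x x' z z' u u' → ((u - u') - a * (z - z')) + a * ((z - z') - a * a * (x - x')) ≡ (u - u') - a * a * a * (x - x')
        eq₂ = solve-∀

        eq₃ : ∀ a b c x x' y y' z z' v v' →
          ((v - v') - (b * (z - z') - c * (y - y'))) + b * ((z - z') - a * a * (x - x')) - c * ((y - y') - a * (x - x'))
          + ((x - x') * a * a) * ((b + y') - a * x') - ((x - x') * a) * ((c + z') - a * y')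
          ≡ (v - v') - (x - x') * a * (a * a * x' - (+ 2) * a * y' + z')
        eq₃ = solve-∀

        eq₄ : ∀ f b c y y' z z' v v' → ((f + v) - (b * z - c * y)) - ((f + v') - (b * z' - c * y')) ≡ (v - v') - (b * (z - z') - c * (y - y'))
        eq₄ = solve-∀

        Δu' : Z ((ι u - ι u') - ι a * (ι z - ι z'))
        Δu' = E₄.edge x (proj₁ r) s ⊖ E₄.edge x' (proj₁ r) s by eq₁ (ι a) (ι d) (ι z) (ι z') (ι u) (ι u')

        Δv' : Z ((ι v - ι v') - (ι b * (ι z - ι z') - ι c * (ι y - ι y')))
        Δv' = E₅.edge x r s ⊖ E₅.edge x' r s by eq₄ (ι f) (ι b) (ι c) (ι y) (ι y') (ι z) (ι z') (ι v) (ι v')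

      step₅-inc : ∀ {u l l'} → Inc u l → Inc u l' → Step₅ (ι (col S₅ u)) (L₅ l) (L₅ l')
      step₅-inc {u} {l} {l'} (s , e) (_ , e') =
        subst₂ (λ l l' → Step₅ (ι (col S₅ u)) (L₅ l) (L₅ l')) e e' (step₅-ν (col S₅ l) (col S₅ l') u s)

      noCycle₅-4 : NoCycle 2
      noCycle₅-4 r (x₄ ∷ x₃ ∷ x₂ ∷ x₁ ∷ []) (y₄ ∷ y₃ ∷ y₂ ∷ y₁ ∷ []) h₄ g₄ e x₃≢y₃ x₁≢y₁ = go (side S₅ r) refl
        where
        u₁ = ν S₅ x₁ r
        u₂ = ν S₅ x₂ u₁
        u₃ = ν S₅ x₃ u₂
        v₁ = ν S₅ y₁ r
        v₂ = ν S₅ y₂ v₁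
        v₃ = ν S₅ y₃ v₂
        h₃ = bad-tail r x₄ (x₃ ∷ x₂ ∷ x₁ ∷ []) h₄
        h₂ = bad-tail r x₃ (x₂ ∷ x₁ ∷ []) h₃
        x₂≢r = bad⇒≢ r x₂ x₁ ([]) h₂
        x₃≢x₁ = bad⇒≢ r x₃ x₂ (x₁ ∷ []) h₃
        x₄≢x₂ = bad⇒≢ r x₄ x₃ (x₂ ∷ x₁ ∷ []) h₄
        y₄≢y₂ = bad⇒≢ r y₄ y₃ (y₂ ∷ y₁ ∷ []) g₄

        go : ∀ b → side S₅ r ≡ b → ⊥
        go true s₀ = no-4-cycle
          (step₅-inc (ν-inc x₂ u₁ s₁) (inc-ν x₃ u₂ s₂))
          (step₅-inc (ν-inc x₄ u₃ s₃) (subst (λ u → Inc u v₃) (sym e) (ν-inc y₄ v₃ t₃)))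
          (step₅-inc (inc-ν y₃ v₂ t₂) (ν-inc y₂ v₁ t₁))
          (step₅-inc (inc-ν y₁ r s₀) (inc-ν x₁ r s₀))
          -- Both words end in the same vertex, so x₄ and y₄ are equal.
          (x₄≢x₂ ∘ sym) (y₄≢y₂ ∘ trans (sym (head-≡ e))) (x₂≢r ∘ sym) (ι-≢ (x₃≢x₁ ∘ sym)) (ι-≢ x₃≢y₃)
          where
          s₁ = side-flip x₁ r s₀
          s₂ = side-flip x₂ u₁ s₁
          s₃ = side-flip x₃ u₂ s₂
          t₁ = side-flip y₁ r s₀
          t₂ = side-flip y₂ v₁ t₁
          t₃ = side-flip y₃ v₂ t₂
        go false s₀ = no-4-cycle
          (step₅-inc (ν-inc x₁ r s₀) (inc-ν x₂ u₁ s₁))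
          (step₅-inc (ν-inc x₃ u₂ s₂) (inc-ν x₄ u₃ s₃))
          (step₅-inc (subst (Inc v₃) (sym e) (inc-ν y₄ v₃ t₃)) (ν-inc y₃ v₂ t₂))
          (step₅-inc (inc-ν y₂ v₁ t₁) (ν-inc y₁ r s₀))
          (x₃≢x₁ ∘ sym) x₃≢y₃ (x₁≢y₁ ∘ sym) (ι-≢ (x₂≢r ∘ sym)) (ι-≢ (x₄≢x₂ ∘ sym))
          where
          s₁ = side-flip x₁ r s₀
          s₂ = side-flip x₂ u₁ s₁
          s₃ = side-flip x₃ u₂ s₂
          t₁ = side-flip y₁ r s₀
          t₂ = side-flip y₂ v₁ t₁
          t₃ = side-flip y₃ v₂ t₂

      noCycle₅-5 : NoCycle 3
      noCycle₅-5 r (x₅ ∷ x₄ ∷ x₃ ∷ x₂ ∷ x₁ ∷ []) (y₅ ∷ y₄ ∷ y₃ ∷ y₂ ∷ y₁ ∷ []) h₅ g₅ e x₄≢y₄ x₁≢y₁ = go (side S₅ r) refl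
        where
        u₁ = ν S₅ x₁ r
        u₂ = ν S₅ x₂ u₁
        u₃ = ν S₅ x₃ u₂
        u₄ = ν S₅ x₄ u₃
        v₁ = ν S₅ y₁ r
        v₂ = ν S₅ y₂ v₁
        v₃ = ν S₅ y₃ v₂
        v₄ = ν S₅ y₄ v₃
        h₄ = bad-tail r x₅ (x₄ ∷ x₃ ∷ x₂ ∷ x₁ ∷ []) h₅
        h₃ = bad-tail r x₄ (x₃ ∷ x₂ ∷ x₁ ∷ []) h₄
        h₂ = bad-tail r x₃ (x₂ ∷ x₁ ∷ []) h₃
        x₂≢r = bad⇒≢ r x₂ x₁ ([]) h₂
        x₃≢x₁ = bad⇒≢ r x₃ x₂ (x₁ ∷ []) h₃
        x₄≢x₂ = bad⇒≢ r x₄ x₃ (x₂ ∷ x₁ ∷ []) h₄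
        x₅≢x₃ = bad⇒≢ r x₅ x₄ (x₃ ∷ x₂ ∷ x₁ ∷ []) h₅
        g₄ = bad-tail r y₅ (y₄ ∷ y₃ ∷ y₂ ∷ y₁ ∷ []) g₅
        g₃ = bad-tail r y₄ (y₃ ∷ y₂ ∷ y₁ ∷ []) g₄
        g₂ = bad-tail r y₃ (y₂ ∷ y₁ ∷ []) g₃
        y₂≢r = bad⇒≢ r y₂ y₁ ([]) g₂
        y₃≢y₁ = bad⇒≢ r y₃ y₂ (y₁ ∷ []) g₃
        y₄≢y₂ = bad⇒≢ r y₄ y₃ (y₂ ∷ y₁ ∷ []) g₄
        y₅≢y₃ = bad⇒≢ r y₅ y₄ (y₃ ∷ y₂ ∷ y₁ ∷ []) g₅

        go : ∀ b → side S₅ r ≡ b → ⊥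
        go true s₀ = no-5-cycle (
          (step₅-inc (ν-inc x₂ u₁ s₁) (inc-ν x₃ u₂ s₂)) ,
          (step₅-inc (ν-inc x₄ u₃ s₃) (inc-ν x₅ u₄ s₄)) ,
          (step₅-inc (subst (Inc v₄) (sym e) (inc-ν y₅ v₄ t₄)) (ν-inc y₄ v₃ t₃)) ,
          (step₅-inc (inc-ν y₃ v₂ t₂) (ν-inc y₂ v₁ t₁)) ,
          (step₅-inc (inc-ν y₁ r s₀) (inc-ν x₁ r s₀)))
          (x₄≢x₂ ∘ sym) x₄≢y₄ y₄≢y₂ y₂≢r (x₂≢r ∘ sym) (ι-≢ (x₅≢x₃ ∘ sym)) (ι-≢ (y₅≢y₃ ∘ trans (sym (head-≡ e)))) (ι-≢ y₃≢y₁) (ι-≢ (x₁≢y₁ ∘ sym))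
          where
          s₁ = side-flip x₁ r s₀
          s₂ = side-flip x₂ u₁ s₁
          s₃ = side-flip x₃ u₂ s₂
          s₄ = side-flip x₄ u₃ s₃
          t₁ = side-flip y₁ r s₀
          t₂ = side-flip y₂ v₁ t₁
          t₃ = side-flip y₃ v₂ t₂
          t₄ = side-flip y₄ v₃ t₃
        go false s₀ = no-5-cycle (
          (step₅-inc (ν-inc x₁ r s₀) (inc-ν x₂ u₁ s₁)) ,
          (step₅-inc (ν-inc x₃ u₂ s₂) (inc-ν x₄ u₃ s₃)) ,
          (step₅-inc (ν-inc x₅ u₄ s₄) (subst (λ u → Inc u v₄) (sym e) (ν-inc y₅ v₄ t₄))) ,
          (step₅-inc (inc-ν y₄ v₃ t₃) (ν-inc y₃ v₂ t₂)) ,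
          (step₅-inc (inc-ν y₂ v₁ t₁) (ν-inc y₁ r s₀)))
          (x₃≢x₁ ∘ sym) (x₅≢x₃ ∘ sym) (y₅≢y₃ ∘ trans (sym (head-≡ e))) y₃≢y₁ (x₁≢y₁ ∘ sym) (ι-≢ (x₄≢x₂ ∘ sym)) (ι-≢ x₄≢y₄) (ι-≢ y₄≢y₂) (ι-≢ y₂≢r)
          where
          s₁ = side-flip x₁ r s₀
          s₂ = side-flip x₂ u₁ s₁
          s₃ = side-flip x₃ u₂ s₂
          s₄ = side-flip x₄ u₃ s₃
          t₁ = side-flip y₁ r s₀
          t₂ = side-flip y₂ v₁ t₁
          t₃ = side-flip y₃ v₂ t₂
          t₄ = side-flip y₄ v₃ t₃

      S₅-unique : ∀ {n} → n ℕ.≤ 5 → Unique n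
      S₅-unique {0} _ = unique₀
      S₅-unique {1} _ = unique₁
      S₅-unique {2} _ = E₅.extend-unique (E₄.extend-unique (S₃-unique (ℕ.m≤m+n 2 1)))
      S₅-unique {3} _ = E₅.extend-unique (E₄.extend-unique (S₃-unique (ℕ.m≤m+n 3 0)))
      S₅-unique {4} _ = unique-step (S₅-unique (ℕ.m≤m+n 3 2)) noCycle₅-4
      S₅-unique {5} _ = unique-step (S₅-unique (ℕ.m≤m+n 4 1)) noCycle₅-5
      S₅-unique {suc (suc (suc (suc (suc (suc _)))))} (ℕ.s≤s (ℕ.s≤s (ℕ.s≤s (ℕ.s≤s (ℕ.s≤s ())))))

-- Sums over words and bounds for the danger.

module Counting where

  open import Data.Empty using (⊥)
  open import Data.Fin as Fin using (Fin; zero; suc)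
  import Data.Fin.Properties as Fin
  open import Data.Nat
  open import Data.Nat.Properties
  open import Data.Nat.Tactic.RingSolver using (solve-∀)
  open import Data.Product using (∃; _,_)
  open import Data.Unit using (⊤)
  open import Data.Sum using (_⊎_; inj₁; inj₂)
  open import Data.Vec using (Vec; []; _∷_)
  open import Function using (_∘_)
  open import Relation.Binary.PropositionalEquality using (_≡_; _≢_; refl; sym; trans; cong; cong₂; subst; module ≡-Reasoning)
  open import Relation.Nullary using (Dec; yes; no; contradiction)
  open import Algebra.Properties.Semiring.Sum +-*-semiring using (sum-cong-≗; ∑-distrib-+; ∑-comm; *-distribˡ-sum) renaming (sum to ∑)
  open Colourings using (𝟙; Coloured; module Words)

  ∑-mono : ∀ {n} {f g : Fin n → ℕ} → (∀ i → f i ≤ g i) → ∑ f ≤ ∑ g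
  ∑-mono {zero}  h = z≤n
  ∑-mono {suc n} h = +-mono-≤ (h zero) (∑-mono (h ∘ suc))

  ∑-const : ∀ n c → ∑ {n} (λ _ → c) ≡ n * c
  ∑-const zero    c = refl
  ∑-const (suc n) c = cong (c +_) (∑-const n c)

  ∑-bound : ∀ {n} (f : Fin n → ℕ) c → (∀ i → f i ≤ c) → ∑ f ≤ n * c
  ∑-bound {n} f c h = ≤-trans (∑-mono h) (≤-reflexive (∑-const n c))

  ∑-pick : ∀ {n} (f : Fin n → ℕ) i → f i ≤ ∑ f
  ∑-pick f zero    = m≤m+n _ _
  ∑-pick f (suc i) = ≤-trans (∑-pick (f ∘ suc) i) (m≤n+m _ _)

  ∑-≢0 : ∀ {n} (f : Fin n → ℕ) → ∑ f ≢ 0 → ∃ λ i → f i ≢ 0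
  ∑-≢0 {zero}  f h = contradiction refl h
  ∑-≢0 {suc n} f h with f zero ≟ 0
  ... | no f0≢0  = zero , f0≢0
  ... | yes f0≡0 = let i , p = ∑-≢0 (f ∘ suc) (λ e → h (cong₂ _+_ f0≡0 e)) in suc i , p

  ∑-≤1 : ∀ {n} (f : Fin n → ℕ) → (∀ i → f i ≤ 1) → (∀ i j → f i ≢ 0 → f j ≢ 0 → i ≡ j) → ∑ f ≤ 1
  ∑-≤1 {zero}  f _ _ = z≤n
  ∑-≤1 {suc n} f f≤1 uniq with f zero ≟ 0 | ∑ (f ∘ suc) ≟ 0
  ... | yes f0≡0 | _         = subst (λ k → k + ∑ (f ∘ suc) ≤ 1) (sym f0≡0)
          (∑-≤1 (f ∘ suc) (f≤1 ∘ suc) (λ i j p q → Fin.suc-injective (uniq (suc i) (suc j) p q)))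
  ... | no _     | yes rest≡0 = subst (λ k → f zero + k ≤ 1) (sym rest≡0) (subst (_≤ 1) (sym (+-identityʳ _)) (f≤1 zero))
  ... | no f0≢0  | no rest≢0 with ∑-≢0 (f ∘ suc) rest≢0
  ...   | i , fi≢0 with uniq zero (suc i) f0≢0 fi≢0
  ...     | ()

  ∑-<⇒∃< : ∀ {n} (f g : Fin n → ℕ) → ∑ f < ∑ g → ∃ λ i → f i < g i
  ∑-<⇒∃< {zero}  f g ()
  ∑-<⇒∃< {suc n} f g h with f zero <? g zero
  ... | yes f0<g0 = zero , f0<g0
  ... | no f0≮g0 = let i , p = ∑-<⇒∃< (f ∘ suc) (g ∘ suc)
                         (+-cancelˡ-< (g zero) _ _ (≤-<-trans (+-monoˡ-≤ _ (≮⇒≥ f0≮g0)) h))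
                   in suc i , p

  𝟙-≤1 : ∀ {P : Set} (d : Dec P) → 𝟙 d ≤ 1
  𝟙-≤1 (yes _) = s≤s z≤n
  𝟙-≤1 (no _)  = z≤n

  𝟙-≢0 : ∀ {P : Set} (d : Dec P) → 𝟙 d ≢ 0 → P
  𝟙-≢0 (yes p) _ = p
  𝟙-≢0 (no _)  h = contradiction refl h

  𝟙-yes : ∀ {P : Set} (d : Dec P) → P → 𝟙 d ≡ 1
  𝟙-yes (yes _) _ = refl
  𝟙-yes (no ¬p) p = contradiction p ¬p

  ∑-𝟙≟ : ∀ {n} (c : Fin n) → (∑ λ x → 𝟙 (x Fin.≟ c)) ≤ 1
  ∑-𝟙≟ c = ∑-≤1 _ (λ x → 𝟙-≤1 (x Fin.≟ c)) (λ x y p p' → trans (𝟙-≢0 (x Fin.≟ c) p) (sym (𝟙-≢0 (y Fin.≟ c) p')))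

  isZero : ℕ → ℕ
  isZero zero    = 1
  isZero (suc _) = 0

  isZero-≤1 : ∀ k → isZero k ≤ 1
  isZero-≤1 zero    = s≤s z≤n
  isZero-≤1 (suc k) = z≤n

  isZero-anti : ∀ {j k} → j ≤ k → isZero k ≤ isZero j
  isZero-anti {zero}  {k}     _ = isZero-≤1 k
  isZero-anti {suc j} {suc k} _ = z≤n

  isZero-≢0 : ∀ k → isZero k ≢ 0 → k ≡ 0
  isZero-≢0 zero    _ = refl
  isZero-≢0 (suc k) h = contradiction refl h

  module WordSums (q : ℕ) where

    Word : ℕ → Set
    Word = Vec (Fin q)

    Σw : ∀ n → (Word n → ℕ) → ℕ
    Σw zero    f = f []
    Σw (suc n) f = Σw n (λ w → ∑ λ x → f (x ∷ w))

    Σw-mono : ∀ n {f g : Word n → ℕ} → (∀ w → f w ≤ g w) → Σw n f ≤ Σw n g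
    Σw-mono zero    h = h []
    Σw-mono (suc n) h = Σw-mono n (λ w → ∑-mono (λ x → h (x ∷ w)))

    Σw-cong : ∀ n {f g : Word n → ℕ} → (∀ w → f w ≡ g w) → Σw n f ≡ Σw n g
    Σw-cong zero    h = h []
    Σw-cong (suc n) h = Σw-cong n (λ w → sum-cong-≗ (λ x → h (x ∷ w)))

    Σw-+ : ∀ n (f g : Word n → ℕ) → Σw n (λ w → f w + g w) ≡ Σw n f + Σw n g
    Σw-+ zero    f g = refl
    Σw-+ (suc n) f g = trans (Σw-cong n (λ w → ∑-distrib-+ (λ x → f (x ∷ w)) (λ x → g (x ∷ w)))) (Σw-+ n _ _)

    Σw-* : ∀ n c (f : Word n → ℕ) → Σw n (λ w → c * f w) ≡ c * Σw n f
    Σw-* zero    c f = refl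
    Σw-* (suc n) c f = trans (Σw-cong n (λ w → sym (*-distribˡ-sum c (λ x → f (x ∷ w))))) (Σw-* n c _)

    Σw-const : ∀ n c → Σw n (λ _ → c) ≡ q ^ n * c
    Σw-const zero    c = sym (*-identityˡ c)
    Σw-const (suc n) c = trans (Σw-cong n (λ _ → ∑-const q c)) (trans (Σw-const n (q * c))
      (trans (sym (*-assoc (q ^ n) q c)) (cong (_* c) (*-comm (q ^ n) q))))

    Σw-∑ : ∀ n {m} (f : Fin m → Word n → ℕ) → Σw n (λ w → ∑ λ i → f i w) ≡ ∑ λ i → Σw n (f i)
    Σw-∑ zero    f = refl
    Σw-∑ (suc n) f = trans (Σw-cong n (λ w → ∑-comm (λ x i → f i (x ∷ w)))) (Σw-∑ n (λ i w → ∑ λ x → f i (x ∷ w)))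

    Σw-≢0 : ∀ n (f : Word n → ℕ) → Σw n f ≢ 0 → ∃ λ w → f w ≢ 0
    Σw-≢0 zero    f h = [] , h
    Σw-≢0 (suc n) f h = let w , p = Σw-≢0 n _ h; x , p' = ∑-≢0 _ p in x ∷ w , p'

    Σw-≤1 : ∀ n (f : Word n → ℕ) → (∀ w → f w ≤ 1) → (∀ w w' → f w ≢ 0 → f w' ≢ 0 → w ≡ w') → Σw n f ≤ 1
    Σw-≤1 zero    f f≤1 uniq = f≤1 []
    Σw-≤1 (suc n) f f≤1 uniq = Σw-≤1 n _
      (λ w → ∑-≤1 _ (λ x → f≤1 (x ∷ w)) (λ x y p p' → cong Data.Vec.head (uniq (x ∷ w) (y ∷ w) p p')))
      (λ w w' p p' → let x , h = ∑-≢0 _ p; y , h' = ∑-≢0 _ p' in cong Data.Vec.tail (uniq (x ∷ w) (y ∷ w') h h'))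

    Σw-<⇒∃< : ∀ n (f g : Word n → ℕ) → Σw n f < Σw n g → ∃ λ w → f w < g w
    Σw-<⇒∃< zero    f g h = [] , h
    Σw-<⇒∃< (suc n) f g h = let w , p = Σw-<⇒∃< n _ _ h; x , p' = ∑-<⇒∃< _ _ p in x ∷ w , p'

  -- The sum of 2 + j over j ≤ k, which collects the bounds for `E` at the successive lengths.
  C : ℕ → ℕ
  C zero    = 2
  C (suc k) = C k + (3 + k)

  module Danger {q} (S : Coloured q) .{{_ : NonZero q}} where
    open Coloured S renaming (_≟_ to _≟ⱽ_)
    open Words S
    open WordSums q

    N : ℕ → V → V → ℕ
    N zero    u c = 𝟙 (u ≟ⱽ c)
    N (suc k) u c = ∑ λ x → N k (ν x u) c

    N₁-≤1 : ∀ u c → N 1 u c ≤ 1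
    N₁-≤1 u c = ∑-≤1 _ (λ x → 𝟙-≤1 (ν x u ≟ⱽ c))
      (λ x y p p' → head-≡ (trans (𝟙-≢0 (ν x u ≟ⱽ c) p) (sym (𝟙-≢0 (ν y u ≟ⱽ c) p'))))

    N₁-end : ∀ u c → N 1 u c ≡ ∑ λ z → N 0 u (ν z c)
    N₁-end u c = ≤-antisym
      (le (N₁-≤1 u c) λ p → let x , h = ∑-≢0 _ p; e = 𝟙-≢0 (ν x u ≟ⱽ c) h in
        ≤-trans (≤-reflexive (sym (𝟙-yes (u ≟ⱽ ν (col u) c) (trans (sym (ν-back x u)) (cong (ν (col u)) e))))) (∑-pick (λ z → N 0 u (ν z c)) (col u)))
      (le (∑-≤1 _ (λ z → 𝟙-≤1 (u ≟ⱽ ν z c)) (λ x y p p' → head-≡ (trans (sym (𝟙-≢0 (u ≟ⱽ ν x c) p)) (𝟙-≢0 (u ≟ⱽ ν y c) p'))))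
        λ p → let z , h = ∑-≢0 _ p; e = 𝟙-≢0 (u ≟ⱽ ν z c) h in
        ≤-trans (≤-reflexive (sym (𝟙-yes (ν (col c) u ≟ⱽ c) (trans (cong (ν (col c)) e) (ν-back z c))))) (∑-pick (λ x → N 0 (ν x u) c) (col c)))
      where
      le : ∀ {m n} → m ≤ 1 → (m ≢ 0 → 1 ≤ n) → m ≤ n
      le {zero}  _   _ = z≤n
      le {suc m} m≤1 h = ≤-trans m≤1 (h λ ())

    N-end : ∀ k u c → N (suc k) u c ≡ ∑ λ z → N k u (ν z c)
    N-end zero    u c = N₁-end u c
    N-end (suc k) u c = trans (sum-cong-≗ (λ x → N-end k (ν x u) c)) (∑-comm (λ x z → N k (ν x u) (ν z c)))

    Σw-N : ∀ n r c → Σw n (λ w → 𝟙 (act r w ≟ⱽ c)) ≡ N n r c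
    Σw-N zero    r c = refl
    Σw-N (suc n) r c = begin
      Σw n (λ w → N 1 (act r w) c)                       ≡⟨ Σw-cong n (λ w → N₁-end (act r w) c) ⟩
      Σw n (λ w → ∑ λ z → 𝟙 (act r w ≟ⱽ ν z c))          ≡⟨ Σw-∑ n (λ z w → 𝟙 (act r w ≟ⱽ ν z c)) ⟩
      (∑ λ z → Σw n (λ w → 𝟙 (act r w ≟ⱽ ν z c)))        ≡⟨ sum-cong-≗ (λ z → Σw-N n r (ν z c)) ⟩
      (∑ λ z → N n r (ν z c))                            ≡⟨ N-end n r c ⟨
      N (suc n) r c                                      ∎
      where open ≡-Reasoning

    hit : ∀ {n} → V → V → Word n → ℕ
    hit c r []      = 𝟙 (r ≟ⱽ c)
    hit c r (x ∷ w) = 𝟙 (act r (x ∷ w) ≟ⱽ c) + hit c r w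

    hit-end : ∀ {n} c r (w : Word n) → act r w ≡ c → 1 ≤ hit c r w
    hit-end c r []      e = ≤-reflexive (sym (𝟙-yes (r ≟ⱽ c) e))
    hit-end c r (x ∷ w) e = ≤-trans (≤-reflexive (sym (𝟙-yes (act r (x ∷ w) ≟ⱽ c) e))) (m≤m+n _ _)

    bad-mono : ∀ {n} r x (w : Word n) → bad r w ≤ bad r (x ∷ w)
    bad-mono r x []      = z≤n
    bad-mono r x (y ∷ w) = m≤n+m _ _

    -- Each step after the first backtracks for at most one of the q colours, so a word has at most
    -- n / q backtracking steps on average.
    Σbad : ∀ n r → q * Σw n (bad r) ≤ n * q ^ n
    Σbad zero          r = ≤-reflexive (*-zeroʳ q)
    Σbad (suc zero)    r = ≤-trans (≤-reflexive (trans (cong (q *_) (trans (∑-const q 0) (*-zeroʳ q))) (*-zeroʳ q))) z≤n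
    Σbad (suc (suc n)) r = begin
      q * Σw (suc n) (λ w → ∑ λ x → bad r (x ∷ w))
        ≤⟨ *-monoʳ-≤ q (Σw-mono (suc n) count) ⟩
      q * Σw (suc n) (λ w → 1 + q * bad r w)
        ≡⟨ cong (q *_) (trans (Σw-+ (suc n) (λ _ → 1) (λ w → q * bad r w)) (cong₂ _+_ (Σw-const (suc n) 1) (Σw-* (suc n) q (bad r)))) ⟩
      q * (q ^ suc n * 1 + q * Σw (suc n) (bad r))
        ≤⟨ *-monoʳ-≤ q (+-monoʳ-≤ (q ^ suc n * 1) (Σbad (suc n) r)) ⟩
      q * (q ^ suc n * 1 + suc n * q ^ suc n)
        ≡⟨ eq q (q ^ suc n) n ⟩
      suc (suc n) * q ^ suc (suc n) ∎
      where
      open ≤-Reasoning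

      eq : ∀ q Q n → q * (Q * 1 + (1 + n) * Q) ≡ (2 + n) * (q * Q)
      eq = solve-∀

      count : ∀ (w : Word (suc n)) → (∑ λ x → bad r (x ∷ w)) ≤ 1 + q * bad r w
      count (y ∷ w) = begin
        (∑ λ x → 𝟙 (x Fin.≟ col (act r w)) + bad r (y ∷ w))
          ≡⟨ ∑-distrib-+ (λ x → 𝟙 (x Fin.≟ col (act r w))) (λ _ → bad r (y ∷ w)) ⟩
        (∑ λ x → 𝟙 (x Fin.≟ col (act r w))) + ∑ {q} (λ _ → bad r (y ∷ w))
          ≤⟨ +-mono-≤ (∑-𝟙≟ (col (act r w)))
                      (≤-reflexive (∑-const q (bad r (y ∷ w)))) ⟩
        1 + q * bad r (y ∷ w) ∎

    -- The robber stays on the vertices `on v`. The paths on v – near v – far only serve to make the graph connected,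
    -- and are long enough that a cop at `far` threatens nothing.
    data Loc : Set where
      on near : V → Loc
      far     : Loc

    LAdj : Loc → Loc → Set
    LAdj (on u)   (on v)   = ∃ λ x → ν x u ≡ v
    LAdj (on u)   (near v) = u ≡ v
    LAdj (near u) (on v)   = u ≡ v
    LAdj (near _) far      = ⊤
    LAdj far      (near _) = ⊤
    LAdj far      far      = ⊤
    LAdj _        _        = ⊥

    Move : Loc → Loc → Set
    Move ℓ ℓ' = ℓ' ≡ ℓ ⊎ LAdj ℓ ℓ'

    -- E k u ℓ bounds the number of walks of length k from u to where a cop at ℓ can be after one move,
    -- and D k u ℓ the number of walks of length k from u that pass there.
    E : ℕ → V → Loc → ℕ
    E k u (on c)   = N k u c + N (suc k) u c
    E k u (near c) = N k u c
    E k u far      = 0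

    D : ℕ → V → Loc → ℕ
    D zero    u ℓ = E zero u ℓ
    D (suc k) u ℓ = q * D k u ℓ + E (suc k) u ℓ

    hitᴸ : ∀ {n} → Loc → V → Word n → ℕ
    hitᴸ (on c) r w = hit c r w
    hitᴸ _      r w = 0

    E-move : ∀ k u {ℓ c} → Move ℓ (on c) → N k u c ≤ E k u ℓ
    E-move k u {on c}   (inj₁ refl)       = m≤m+n _ _
    E-move k u {on c}   (inj₂ (x , refl)) = ≤-trans
      (≤-trans (∑-pick (λ z → N k u (ν z c)) x) (≤-reflexive (sym (N-end k u c)))) (m≤n+m _ _)
    E-move k u {near c} (inj₂ refl)       = ≤-refl

    -- The danger before the cop's move bounds the walks blocked after it, whichever move the cop
    -- makes.
    Σhit : ∀ n r {ℓ ℓ'} → Move ℓ ℓ' → Σw n (hitᴸ ℓ' r) ≤ D n r ℓ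
    Σhit n r {ℓ} {near _} _ = ≤-trans (≤-reflexive (trans (Σw-const n 0) (*-zeroʳ (q ^ n)))) z≤n
    Σhit n r {ℓ} {far}    _ = ≤-trans (≤-reflexive (trans (Σw-const n 0) (*-zeroʳ (q ^ n)))) z≤n
    Σhit zero    r {ℓ} {on c} m = E-move 0 r m
    Σhit (suc n) r {ℓ} {on c} m = begin
      Σw n (λ w → ∑ λ x → 𝟙 (act r (x ∷ w) ≟ⱽ c) + hit c r w)
        ≡⟨ Σw-+ (suc n) (λ w → 𝟙 (act r w ≟ⱽ c)) (λ { (x ∷ w) → hit c r w }) ⟩
      Σw (suc n) (λ w → 𝟙 (act r w ≟ⱽ c)) + Σw n (λ w → ∑ {q} λ x → hit c r w)
        ≡⟨ cong₂ _+_ (Σw-N (suc n) r c) (trans (Σw-cong n (λ w → ∑-const q (hit c r w))) (Σw-* n q (hit c r))) ⟩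
      N (suc n) r c + q * Σw n (hit c r)
        ≤⟨ +-mono-≤ (E-move (suc n) r m) (*-monoʳ-≤ q (Σhit n r m)) ⟩
      E (suc n) r ℓ + q * D n r ℓ
        ≡⟨ +-comm (E (suc n) r ℓ) (q * D n r ℓ) ⟩
      D (suc n) r ℓ ∎
      where open ≤-Reasoning

    -- All walks start at u, so a cop able to reach u threatens every one of them. Hence small
    -- danger also rules out immediate capture.
    E-caught : ∀ k {ℓ u} → Move ℓ (on u) → q ^ k ≤ D k u ℓ
    E-caught zero    {ℓ} {u} m = ≤-trans (≤-reflexive (sym (𝟙-yes (u ≟ⱽ u) refl))) (E-move 0 u m)
    E-caught (suc k) {ℓ} {u} m = ≤-trans (*-monoʳ-≤ q (E-caught k m)) (m≤m+n _ _)

    ΣD-from-ΣE : ∀ n (g : Word n → ℕ) r ℓ B K →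
      (∀ k → k ≤ K → Σw n (λ w → g w * E k (act r w) ℓ) ≤ (2 + k) * (B * q ^ k)) →
      Σw n (λ w → g w * D K (act r w) ℓ) ≤ C K * (B * q ^ K)
    ΣD-from-ΣE n g r ℓ B zero    h = h 0 z≤n
    ΣD-from-ΣE n g r ℓ B (suc K) h = begin
      Σw n (λ w → g w * (q * D K (act r w) ℓ + E (suc K) (act r w) ℓ))
        ≡⟨ Σw-cong n (λ w → eq₁ (g w) q (D K (act r w) ℓ) (E (suc K) (act r w) ℓ)) ⟩
      Σw n (λ w → q * (g w * D K (act r w) ℓ) + g w * E (suc K) (act r w) ℓ)
        ≡⟨ trans (Σw-+ n _ _) (cong (_+ Σw n (λ w → g w * E (suc K) (act r w) ℓ)) (Σw-* n q (λ w → g w * D K (act r w) ℓ))) ⟩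
      q * Σw n (λ w → g w * D K (act r w) ℓ) + Σw n (λ w → g w * E (suc K) (act r w) ℓ)
        ≤⟨ +-mono-≤ (*-monoʳ-≤ q (ΣD-from-ΣE n g r ℓ B K (λ k k≤K → h k (m≤n⇒m≤1+n k≤K)))) (h (suc K) ≤-refl) ⟩
      q * (C K * (B * q ^ K)) + (3 + K) * (B * (q * q ^ K))
        ≡⟨ eq₂ q (C K) B (q ^ K) K ⟩
      C (suc K) * (B * q ^ suc K) ∎
      where
      open ≤-Reasoning

      eq₁ : ∀ g q d e → g * (q * d + e) ≡ q * (g * d) + g * e
      eq₁ = solve-∀

      eq₂ : ∀ q c B Q K → q * (c * (B * Q)) + (3 + K) * (B * (q * Q)) ≡ (c + (3 + K)) * (B * (q * Q))
      eq₂ = solve-∀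

    module _ (t : ℕ) (unique : ∀ {n} → n ≤ suc t → Unique n) where

      -- Reading the last k steps backwards from c leaves q ^ k possible ends of w, and each determines w.
      ΣN : ∀ n → n ≤ suc t → ∀ k r c → Σw n (λ w → isZero (bad r w) * N k (act r w) c) ≤ q ^ k
      ΣN n n≤ zero r c = Σw-≤1 n _
        (λ w → *-mono-≤ (isZero-≤1 (bad r w)) (𝟙-≤1 (act r w ≟ⱽ c)))
        (λ w w' p p' → unique n≤ r w w' (isZero-≢0 _ (left (isZero (bad r w)) _ p)) (isZero-≢0 _ (left (isZero (bad r w')) _ p'))
          (trans (𝟙-≢0 (act r w ≟ⱽ c) (right (isZero (bad r w)) _ p)) (sym (𝟙-≢0 (act r w' ≟ⱽ c) (right (isZero (bad r w')) _ p')))))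
        where
        left : ∀ i j → i * j ≢ 0 → i ≢ 0
        left i j h refl = h refl

        right : ∀ i j → i * j ≢ 0 → j ≢ 0
        right i j h refl = h (*-zeroʳ i)
      ΣN n n≤ (suc k) r c = begin
        Σw n (λ w → isZero (bad r w) * N (suc k) (act r w) c)
          ≡⟨ Σw-cong n (λ w → trans (cong (isZero (bad r w) *_) (N-end k (act r w) c)) (*-distribˡ-sum (isZero (bad r w)) (λ z → N k (act r w) (ν z c)))) ⟩
        Σw n (λ w → ∑ λ z → isZero (bad r w) * N k (act r w) (ν z c))
          ≡⟨ Σw-∑ n (λ z w → isZero (bad r w) * N k (act r w) (ν z c)) ⟩
        (∑ λ z → Σw n (λ w → isZero (bad r w) * N k (act r w) (ν z c)))
          ≤⟨ ∑-bound _ (q ^ k) (λ z → ΣN n n≤ k r (ν z c)) ⟩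
        q * q ^ k ∎
        where open ≤-Reasoning

      -- If w avoids c, the first of the k steps either retraces the last step of w or prolongs w without backtracking.
      ΣN-avoiding : ∀ n → n ≤ t → ∀ k → k ≤ suc n → ∀ r c →
        q * Σw n (λ w → isZero (bad r w + hit c r w) * N k (act r w) c) ≤ k * q ^ k
      ΣN-avoiding n n≤t zero _ r c = ≤-reflexive (trans (cong (q *_) vanish) (*-zeroʳ q))
        where
        term : ∀ (w : Word n) → isZero (bad r w + hit c r w) * N 0 (act r w) c ≡ 0
        term w with act r w ≟ⱽ c
        ... | no _  = *-zeroʳ (isZero (bad r w + hit c r w))
        ... | yes e with bad r w + hit c r w | ≤-trans (hit-end c r w e) (m≤n+m _ (bad r w))
        ...   | suc _ | _ = refl

        vanish : Σw n (λ w → isZero (bad r w + hit c r w) * N 0 (act r w) c) ≡ 0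
        vanish = trans (Σw-cong n term) (trans (Σw-const n 0) (*-zeroʳ (q ^ n)))
      -- Retracing shortens w and k by one each, so k ≤ n + 1 persists. When w is exhausted at most
      -- one step is left, and at most one colour leads from r to c.
      ΣN-avoiding zero n≤t (suc zero) _ r c = begin
        q * (isZero (hit c r []) * N 1 r c) ≤⟨ *-monoʳ-≤ q (*-mono-≤ (isZero-≤1 (hit c r [])) (N₁-≤1 r c)) ⟩
        q * 1                               ≡⟨ *-identityˡ (q * 1) ⟨
        1 * (q * 1)                         ∎
        where open ≤-Reasoning
      ΣN-avoiding zero n≤t (suc (suc k)) (s≤s ())
      ΣN-avoiding (suc n) n<t (suc k) (s≤s k≤) r c = begin
        q * Σw n (λ w → ∑ λ l → good (l ∷ w) * ∑ λ y → N k (ν y (ν l (act r w))) c)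
          ≤⟨ *-monoʳ-≤ q (Σw-mono n λ w → ∑-mono λ l →
               ≤-trans (≤-reflexive (*-distribˡ-sum (good (l ∷ w)) (λ y → N k (ν y (ν l (act r w))) c))) (∑-mono λ y → split w l y)) ⟩
        q * Σw n (λ w → ∑ λ l → ∑ λ y → F (y ∷ l ∷ w) + 𝟙 (y Fin.≟ col (act r w)) * Q w)
          ≡⟨ cong (q *_) (Σw-cong n λ w → trans
               (sum-cong-≗ λ l → ∑-distrib-+ (λ y → F (y ∷ l ∷ w)) (λ y → 𝟙 (y Fin.≟ col (act r w)) * Q w))
               (∑-distrib-+ (λ l → ∑ λ y → F (y ∷ l ∷ w)) (λ l → ∑ λ y → 𝟙 (y Fin.≟ col (act r w)) * Q w))) ⟩
        q * Σw n (λ w → (∑ λ l → ∑ λ y → F (y ∷ l ∷ w)) + ∑ {q} λ l → ∑ λ y → 𝟙 (y Fin.≟ col (act r w)) * Q w)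
          ≡⟨ cong (q *_) (Σw-+ n _ _) ⟩
        q * (Σw (suc (suc n)) F + Σw n (λ w → ∑ {q} λ l → ∑ λ y → 𝟙 (y Fin.≟ col (act r w)) * Q w))
          ≤⟨ *-monoʳ-≤ q (+-mono-≤ (ΣN (suc (suc n)) (s≤s n<t) k r c) (Σw-mono n λ w → ∑-bound {q} _ (Q w) λ l → once w)) ⟩
        q * (q ^ k + Σw n (λ w → q * Q w))
          ≡⟨ cong (λ s → q * (q ^ k + s)) (Σw-* n q Q) ⟩
        q * (q ^ k + q * Σw n Q)
          ≤⟨ *-monoʳ-≤ q (+-monoʳ-≤ (q ^ k) (ΣN-avoiding n (<⇒≤ n<t) k k≤ r c)) ⟩
        q * (q ^ k + k * q ^ k)
          ≡⟨ eq q (q ^ k) k ⟩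
        suc k * q ^ suc k ∎
        where
        open ≤-Reasoning

        good : ∀ {n} → Word n → ℕ
        good w = isZero (bad r w + hit c r w)

        F : Word (suc (suc n)) → ℕ
        F w = isZero (bad r w) * N k (act r w) c

        Q : Word n → ℕ
        Q w = good w * N k (act r w) c

        eq : ∀ q K k → q * (K + k * K) ≡ (1 + k) * (q * K)
        eq = solve-∀

        once : ∀ w → (∑ λ y → 𝟙 (y Fin.≟ col (act r w)) * Q w) ≤ Q w
        once w = begin
          (∑ λ y → 𝟙 (y Fin.≟ col (act r w)) * Q w) ≡⟨ sum-cong-≗ (λ y → *-comm (𝟙 (y Fin.≟ col (act r w))) (Q w)) ⟩
          (∑ λ y → Q w * 𝟙 (y Fin.≟ col (act r w))) ≡⟨ *-distribˡ-sum (Q w) (λ y → 𝟙 (y Fin.≟ col (act r w))) ⟨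
          Q w * (∑ λ y → 𝟙 (y Fin.≟ col (act r w))) ≤⟨ *-monoʳ-≤ (Q w) (∑-𝟙≟ (col (act r w))) ⟩
          Q w * 1                                   ≡⟨ *-identityʳ (Q w) ⟩
          Q w                                       ∎

        split : ∀ w l y → good (l ∷ w) * N k (ν y (ν l (act r w))) c ≤ F (y ∷ l ∷ w) + 𝟙 (y Fin.≟ col (act r w)) * Q w
        split w l y with y Fin.≟ col (act r w)
        ... | no _     = ≤-trans (*-monoˡ-≤ (N k (ν y (ν l (act r w))) c) (isZero-anti (m≤m+n (bad r (l ∷ w)) (hit c r (l ∷ w))))) (m≤m+n _ _)
        ... | yes refl rewrite ν-back l (act r w) =
          ≤-trans (*-monoˡ-≤ (N k (act r w) c) (isZero-anti (+-mono-≤ (bad-mono r l w) (m≤n+m (hit c r w) (𝟙 (act r (l ∷ w) ≟ⱽ c))))))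
                  (≤-reflexive (sym (+-identityʳ (Q w))))

      -- For a cop at c, the term `N (suc k)` in `E k` would cost q ^ (k + 1) by `ΣN`; as w avoids
      -- c, `ΣN-avoiding` lowers this to (k + 1) * q ^ k. A cop beside the core reaches only one
      -- core vertex, and `ΣN` suffices.
      ΣD : ∀ r ℓ → Σw t (λ w → isZero (bad r w + hitᴸ ℓ r w) * D t (act r w) ℓ) ≤ C t * q ^ t
      ΣD r ℓ = ≤-trans (ΣD-from-ΣE t (λ w → isZero (bad r w + hitᴸ ℓ r w)) r ℓ 1 t (ΣE ℓ)) (≤-reflexive (cong (C t *_) (*-identityˡ (q ^ t))))
        where
        open ≤-Reasoning

        visits : ∀ ℓ k c → Σw t (λ w → isZero (bad r w + hitᴸ ℓ r w) * N k (act r w) c) ≤ q ^ k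
        visits ℓ k c = ≤-trans
          (Σw-mono t (λ w → *-monoˡ-≤ (N k (act r w) c) (isZero-anti (m≤m+n (bad r w) (hitᴸ ℓ r w)))))
          (ΣN t (n≤1+n t) k r c)

        eq : ∀ q k Q → (1 + k) * (q * Q) ≡ q * ((1 + k) * Q)
        eq = solve-∀

        ΣE : ∀ ℓ k → k ≤ t → Σw t (λ w → isZero (bad r w + hitᴸ ℓ r w) * E k (act r w) ℓ) ≤ (2 + k) * (1 * q ^ k)
        ΣE (on c) k k≤t = begin
          Σw t (λ w → isZero (bad r w + hit c r w) * (N k (act r w) c + N (suc k) (act r w) c))
            ≡⟨ trans (Σw-cong t (λ w → *-distribˡ-+ (isZero (bad r w + hit c r w)) (N k (act r w) c) (N (suc k) (act r w) c))) (Σw-+ t _ _) ⟩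
          Σw t (λ w → isZero (bad r w + hit c r w) * N k (act r w) c) + Σw t (λ w → isZero (bad r w + hit c r w) * N (suc k) (act r w) c)
            ≤⟨ +-mono-≤ (visits (on c) k c) (*-cancelˡ-≤ q (≤-trans (ΣN-avoiding t ≤-refl (suc k) (s≤s k≤t) r c) (≤-reflexive (eq q k (q ^ k))))) ⟩
          (2 + k) * q ^ k
            ≡⟨ cong ((2 + k) *_) (*-identityˡ (q ^ k)) ⟨
          (2 + k) * (1 * q ^ k) ∎
        ΣE (near c) k k≤t = ≤-trans (visits (near c) k c) (≤-trans (≤-reflexive (sym (*-identityˡ (q ^ k)))) (m≤m+n _ _))
        ΣE far      k k≤t = ≤-trans (≤-reflexive (trans (Σw-cong t (λ w → *-zeroʳ (isZero (bad r w + 0)))) (trans (Σw-const t 0) (*-zeroʳ (q ^ t))))) z≤n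

      -- No cop is avoided here, but there are q times as many words, so the weaker bound of order q
      -- ^ (k + 1) gives the same average.
      ΣD-start : ∀ r ℓ → Σw (suc t) (λ w → isZero (bad r w) * D t (act r w) ℓ) ≤ C t * q ^ suc t
      ΣD-start r ℓ = ΣD-from-ΣE (suc t) (λ w → isZero (bad r w)) r ℓ q t (λ k _ → ΣE ℓ k)
        where
        open ≤-Reasoning

        visits : ∀ k c → Σw (suc t) (λ w → isZero (bad r w) * N k (act r w) c) ≤ q ^ k
        visits k c = ΣN (suc t) ≤-refl k r c

        ΣE : ∀ ℓ k → Σw (suc t) (λ w → isZero (bad r w) * E k (act r w) ℓ) ≤ (2 + k) * (q * q ^ k)
        ΣE (on c) k = begin
          Σw (suc t) (λ w → isZero (bad r w) * (N k (act r w) c + N (suc k) (act r w) c))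
            ≡⟨ trans (Σw-cong (suc t) (λ w → *-distribˡ-+ (isZero (bad r w)) (N k (act r w) c) (N (suc k) (act r w) c)))
                 (Σw-+ (suc t) (λ w → isZero (bad r w) * N k (act r w) c) (λ w → isZero (bad r w) * N (suc k) (act r w) c)) ⟩
          Σw (suc t) (λ w → isZero (bad r w) * N k (act r w) c) + Σw (suc t) (λ w → isZero (bad r w) * N (suc k) (act r w) c)
            ≤⟨ +-mono-≤ (≤-trans (visits k c) (m≤n*m (q ^ k) q)) (≤-trans (visits (suc k) c) (m≤m+n _ (k * (q * q ^ k)))) ⟩
          (2 + k) * (q * q ^ k) ∎
        ΣE (near c) k = ≤-trans (visits k c) (≤-trans (m≤n*m (q ^ k) q) (m≤m+n _ _))
        ΣE far      k = ≤-trans (≤-reflexive (trans (Σw-cong (suc t) (λ w → *-zeroʳ (isZero (bad r w)))) (trans (Σw-const (suc t) 0) (*-zeroʳ (q ^ suc t))))) z≤n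

-- The connected graph and the robber's strategy.

module Pursuit where

  open import Data.Empty using (⊥)
  open import Data.Fin as Fin using (Fin; zero; suc; _↑ˡ_; _↑ʳ_; splitAt)
  import Data.Fin.Properties as Fin
  open import Data.Nat
  open import Data.Nat.Properties
  open import Data.Nat.Tactic.RingSolver using (solve-∀)
  open import Data.Product using (∃; _×_; _,_; proj₁; proj₂)
  open import Data.Unit using (tt)
  open import Data.Sum using (inj₁; inj₂; [_,_]′)
  open import Data.Vec using ([]; _∷_)
  open import Function using (_∘_; Inverse)
  open import Relation.Binary.PropositionalEquality using (_≡_; _≢_; refl; sym; trans; cong; cong₂; subst; subst₂)
  open import Relation.Nullary using (¬_; yes; no; contradiction)
  open import Algebra.Properties.Semiring.Sum +-*-semiring using (sum-cong-≗) renaming (sum to ∑)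
  open Colourings using (𝟙; Coloured; module Words)
  open Counting

  walk-++ : ∀ {n} {G : Graph n} {u v w} → Walk G u v → Walk G v w → Walk G u w
  walk-++ here       q = q
  walk-++ (step a p) q = step a (walk-++ p q)

  walk-reverse : ∀ {n} {G : Graph n} {u v} → Walk G u v → Walk G v u
  walk-reverse         here       = here
  walk-reverse {G = G} (step a p) = walk-++ (walk-reverse p) (step (Graph.sym G a) here)

  connected-to : ∀ {n} {G : Graph n} hub → (∀ u → Walk G u hub) → Connected G
  connected-to hub to u v = walk-++ (to u) (walk-reverse (to v))

  module _ {n m} {G : Graph n} {cs : Cops n m} where

    robPath-snoc : ∀ {k r s s'} → RobPath G cs k r s → Adj G s s' → Free cs s' → RobPath G cs (suc k) r s'
    robPath-snoc stay          a' f' = move a' f' stay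
    robPath-snoc (move a f p) a' f' = move a f (robPath-snoc p a' f')

    robPath-mono : ∀ {k k' r s} → k ≤ k' → RobPath G cs k r s → RobPath G cs k' r s
    robPath-mono _         stay         = stay
    robPath-mono (s≤s k≤k') (move a f p) = move a f (robPath-mono k≤k' p)

  module Play {q} (S : Coloured q) .{{_ : NonZero q}} (extra : ℕ) where
    open Coloured S renaming (_≟_ to _≟ⱽ_)
    open Words S
    open WordSums q
    open Danger S

    -- One vertex for each `on v`, one for each `near v`, and a clique of `suc extra` vertices at
    -- `far`. The parameter pads the graph to a prescribed order.
    order : ℕ
    order = size + (size + suc extra)

    to : Fin size → V
    to = Inverse.to enum

    from : V → Fin size
    from = Inverse.from enum

    to-from : ∀ v → to (from v) ≡ v
    to-from = Inverse.strictlyInverseˡ enum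

    loc : Fin order → Loc
    loc i = [ on ∘ to , (λ j → [ near ∘ to , (λ _ → far) ]′ (splitAt size j)) ]′ (splitAt size i)

    at : V → Fin order
    at v = from v ↑ˡ (size + suc extra)

    beside : V → Fin order
    beside v = size ↑ʳ (from v ↑ˡ suc extra)

    hub : Fin order
    hub = size ↑ʳ (size ↑ʳ zero)

    loc-at : ∀ v → loc (at v) ≡ on v
    loc-at v rewrite Fin.splitAt-↑ˡ size (from v) (size + suc extra) = cong on (to-from v)

    loc-beside : ∀ v → loc (beside v) ≡ near v
    loc-beside v rewrite Fin.splitAt-↑ʳ size (size + suc extra) (from v ↑ˡ suc extra)
                       | Fin.splitAt-↑ˡ size (from v) (suc extra) = cong near (to-from v)

    loc-hub : loc hub ≡ far
    loc-hub rewrite Fin.splitAt-↑ʳ size (size + suc extra) (size ↑ʳ zero)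
                  | Fin.splitAt-↑ʳ size (suc extra) zero = refl

    LAdj-sym : ∀ ℓ ℓ' → LAdj ℓ ℓ' → LAdj ℓ' ℓ
    LAdj-sym (on u)   (on v)   (x , e) = col u , trans (cong (ν (col u)) (sym e)) (ν-back x u)
    LAdj-sym (on u)   (near v) e = sym e
    LAdj-sym (near u) (on v)   e = sym e
    LAdj-sym (near u) far      _ = tt
    LAdj-sym far      (near v) _ = tt
    LAdj-sym far      far      _ = tt

    graph : Graph order
    graph = record
      { Adj    = λ i j → i ≢ j × LAdj (loc i) (loc j)
      ; sym    = λ {i} {j} (i≢j , a) → i≢j ∘ sym , LAdj-sym (loc i) (loc j) a
      ; irrefl = λ (i≢i , _) → i≢i refl
      }

    edge : ∀ i j {ℓ ℓ'} → loc i ≡ ℓ → loc j ≡ ℓ' → ℓ ≢ ℓ' → LAdj ℓ ℓ' → Adj graph i j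
    edge i j refl refl ℓ≢ℓ' a = ℓ≢ℓ' ∘ cong loc , a

    graph-connected : Connected graph
    graph-connected = connected-to hub to-hub
      where
      to-hub : ∀ i → Walk graph i hub
      to-hub i with loc i in e
      ... | on v   = step (edge i (beside v) e (loc-beside v) (λ ()) refl)
                       (step (edge (beside v) hub (loc-beside v) loc-hub (λ ()) tt) here)
      ... | near v = step (edge i hub e loc-hub (λ ()) tt) here
      ... | far with i Fin.≟ hub
      ...   | yes refl = here
      ...   | no i≢hub = step (i≢hub , subst₂ LAdj (sym e) (sym loc-hub) tt) here

    copMove-loc : ∀ {m} {cs cs' : Cops order m} → CopMove graph cs cs' → ∀ i → Move (loc (cs i)) (loc (cs' i))
    copMove-loc mv i with mv i
    ... | inj₁ e       = inj₁ (cong loc e)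
    ... | inj₂ (_ , a) = inj₂ a

    word-path : ∀ {m n} (cs : Cops order m) r (w : Word n) → (∀ i → hitᴸ (loc (cs i)) r w ≡ 0) → RobPath graph cs n (at r) (at (act r w))
    word-path cs r []      _ = stay
    word-path cs r (x ∷ w) h = robPath-snoc (word-path cs r w (λ i → hit-tail (loc (cs i)) (h i)))
      (edge (at (act r w)) (at (act r (x ∷ w))) (loc-at (act r w)) (loc-at (act r (x ∷ w))) (λ { e → ν-≢ x (act r w) (sym (on-injective e)) }) (x , refl))
      free
      where
      on-injective : ∀ {u v} → on u ≡ on v → u ≡ v
      on-injective refl = refl

      hit-tail : ∀ ℓ → hitᴸ ℓ r (x ∷ w) ≡ 0 → hitᴸ ℓ r w ≡ 0
      hit-tail (on c)   e = m+n≡0⇒n≡0 (𝟙 (act r (x ∷ w) ≟ⱽ c)) e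
      hit-tail (near _) e = refl
      hit-tail far      e = refl

      free : Free cs (at (act r (x ∷ w)))
      free i e = <⇒≢ (hit-end _ r (x ∷ w) refl)
        (sym (subst (λ ℓ → hitᴸ ℓ r (x ∷ w) ≡ 0) (trans (cong loc e) (loc-at (act r (x ∷ w)))) (h i)))

    module Robber (t : ℕ) (unique : ∀ {n} → n ≤ suc t → Unique n) (large : 4 * suc t ≤ q)
                  {m} (few : 16 * (m * C t) ≤ q ^ t) where

      Q : ℕ
      Q = q ^ t

      Safe : Cops order m → V → Set
      Safe cs r = 4 * (∑ λ i → D t r (loc (cs i))) < Q

      -- An averaging argument: `F` adds Q for each obstruction counted by b and four times the
      -- danger. Its average is at most Q / 2 + Q / 4, so some word has `F w` below Q, which forces
      -- b to vanish and the danger to be small. The separate b' is there because the danger bound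
      -- for cop i assumes only that cop i is avoided.
      select : ∀ n (b : Word n → ℕ) (b' d : Fin m → Word n → ℕ) → 4 * Σw n b ≤ 2 * q ^ n →
        (∀ i w → b' i w ≤ b w) → (∀ i → Σw n (λ w → isZero (b' i w) * d i w) ≤ C t * q ^ n) →
        ∃ λ w → b w ≡ 0 × 4 * (∑ λ i → d i w) < Q
      select n b b' d Σb b'≤b Σd = w , b≡0 , d<Q
        where
        B : ℕ
        B = q ^ n

        s : Word n → ℕ
        s w = ∑ λ i → isZero (b' i w) * d i w

        F : Word n → ℕ
        F w = Q * b w + 4 * s w

        eq₁ : ∀ Q x y → 4 * (Q * x + 4 * y) ≡ Q * (4 * x) + 16 * y
        eq₁ = solve-∀

        eq₂ : ∀ Q B m c → Q * (2 * B) + 16 * (m * (c * B)) ≡ 2 * (Q * B) + 16 * (m * c) * B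
        eq₂ = solve-∀

        eq₃ : ∀ Q B → 2 * (Q * B) + Q * B + Q * B ≡ 4 * (B * Q)
        eq₃ = solve-∀

        instance
          Q≢0 : NonZero Q
          Q≢0 = m^n≢0 q t
          QB≢0 : NonZero (Q * B)
          QB≢0 = m*n≢0 Q B {{Q≢0}} {{m^n≢0 q n}}

        ΣF : Σw n F < Σw n (λ _ → Q)
        ΣF = *-cancelˡ-< 4 _ _ (begin-strict
          4 * Σw n F
            ≡⟨ cong (4 *_) (trans (Σw-+ n (λ w → Q * b w) (λ w → 4 * s w)) (cong₂ _+_ (Σw-* n Q b) (Σw-* n 4 s))) ⟩
          4 * (Q * Σw n b + 4 * Σw n s)
            ≡⟨ eq₁ Q (Σw n b) (Σw n s) ⟩
          Q * (4 * Σw n b) + 16 * Σw n s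
            ≤⟨ +-mono-≤ (*-monoʳ-≤ Q Σb) (*-monoʳ-≤ 16 (≤-trans (≤-reflexive (Σw-∑ n (λ i w → isZero (b' i w) * d i w))) (∑-bound _ (C t * B) Σd))) ⟩
          Q * (2 * B) + 16 * (m * (C t * B))
            ≡⟨ eq₂ Q B m (C t) ⟩
          2 * (Q * B) + 16 * (m * C t) * B
            ≤⟨ +-monoʳ-≤ (2 * (Q * B)) (*-monoˡ-≤ B few) ⟩
          2 * (Q * B) + Q * B
            <⟨ m<m+n _ (>-nonZero⁻¹ (Q * B)) ⟩
          2 * (Q * B) + Q * B + Q * B
            ≡⟨ eq₃ Q B ⟩
          4 * (B * Q)
            ≡⟨ cong (4 *_) (Σw-const n Q) ⟨
          4 * Σw n (λ _ → Q) ∎)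
          where open ≤-Reasoning

        w : Word n
        w = proj₁ (Σw-<⇒∃< n F (λ _ → Q) ΣF)

        F<Q : F w < Q
        F<Q = proj₂ (Σw-<⇒∃< n F (λ _ → Q) ΣF)

        zero-factor : ∀ k → Q * k < Q → k ≡ 0
        zero-factor zero    _ = refl
        zero-factor (suc k) h = contradiction (m≤m*n Q (suc k)) (<⇒≱ h)

        b≡0 : b w ≡ 0
        b≡0 = zero-factor (b w) (≤-<-trans (m≤m+n _ _) F<Q)

        d<Q : 4 * (∑ λ i → d i w) < Q
        d<Q = ≤-<-trans (≤-trans (*-monoʳ-≤ 4 (≤-reflexive (sum-cong-≗ λ i →
            sym (trans (cong (λ k → isZero k * d i w) (n≤0⇒n≡0 (subst (b' i w ≤_) b≡0 (b'≤b i w)))) (*-identityˡ (d i w))))))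
          (m≤n+m _ (Q * b w))) F<Q

      4Σbad : ∀ n r → n ≤ suc t → 4 * Σw n (bad r) ≤ q ^ n
      4Σbad n r n≤ = *-cancelˡ-≤ q (begin
        q * (4 * Σw n (bad r)) ≡⟨ eq q (Σw n (bad r)) ⟩
        4 * (q * Σw n (bad r)) ≤⟨ *-monoʳ-≤ 4 (Σbad n r) ⟩
        4 * (n * q ^ n)        ≡⟨ *-assoc 4 n (q ^ n) ⟨
        4 * n * q ^ n          ≤⟨ *-monoˡ-≤ (q ^ n) (≤-trans (*-monoʳ-≤ 4 n≤) large) ⟩
        q * q ^ n              ∎)
        where
        open ≤-Reasoning

        eq : ∀ q s → q * (4 * s) ≡ 4 * (q * s)
        eq = solve-∀

      -- The vertex r₀ is only a reference point: the robber is placed directly at the end of the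
      -- chosen walk, so cops may stand on the walk.
      start : V → ∀ cs → ∃ λ r → Safe cs r
      start r₀ cs =
        let w , _ , safe = select (suc t) (bad r₀) (λ _ → bad r₀) (λ i w → D t (act r₀ w) (loc (cs i)))
              (≤-trans (4Σbad (suc t) r₀ ≤-refl) (m≤m+n _ _)) (λ _ _ → ≤-refl) (λ i → ΣD-start t unique r₀ (loc (cs i)))
        in act r₀ w , safe

      respond : ∀ {cs cs'} r → CopMove graph cs cs' → Safe cs r →
        ∃ λ r' → RobPath graph cs' t (at r) (at r') × Safe cs' r'
      respond {cs} {cs'} r mv safe =
        let w , b≡0 , safe' = select t (λ w → bad r w + ∑ λ i → h i w) (λ i w → bad r w + h i w) (λ i w → D t (act r w) (loc (cs' i)))
              few-bad (λ i w → +-monoʳ-≤ (bad r w) (∑-pick (λ i → h i w) i)) (λ i → ΣD t unique r (loc (cs' i)))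
        in act r w
         , word-path cs' r w (λ i → n≤0⇒n≡0 (subst (h i w ≤_) (m+n≡0⇒n≡0 (bad r w) b≡0) (∑-pick (λ i → h i w) i)))
         , safe'
        where
        open ≤-Reasoning

        h : Fin m → Word t → ℕ
        h i w = hitᴸ (loc (cs' i)) r w

        -- Backtracking accounts for at most Q / 4 since q is large, and visits to cops for at most
        -- Q / 4 since the old position was safe.
        few-bad : 4 * Σw t (λ w → bad r w + ∑ λ i → h i w) ≤ 2 * Q
        few-bad = begin
          4 * Σw t (λ w → bad r w + ∑ λ i → h i w)
            ≡⟨ cong (4 *_) (Σw-+ t (bad r) (λ w → ∑ λ i → h i w)) ⟩
          4 * (Σw t (bad r) + Σw t (λ w → ∑ λ i → h i w))
            ≡⟨ *-distribˡ-+ 4 (Σw t (bad r)) _ ⟩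
          4 * Σw t (bad r) + 4 * Σw t (λ w → ∑ λ i → h i w)
            ≤⟨ +-mono-≤ (4Σbad t r (n≤1+n t)) (*-monoʳ-≤ 4 (≤-trans (≤-reflexive (Σw-∑ t h)) (∑-mono λ i → Σhit t r (copMove-loc {cs = cs} {cs'} mv i)))) ⟩
          Q + 4 * (∑ λ i → D t r (loc (cs i)))
            ≤⟨ +-monoʳ-≤ Q (<⇒≤ safe) ⟩
          Q + Q
            ≡⟨ cong (Q +_) (+-identityʳ Q) ⟨
          2 * Q ∎

      safe⇒not-reached : ∀ {cs r} → Safe cs r → ∀ i → ¬ Move (loc (cs i)) (on r)
      safe⇒not-reached {cs} {r} safe i mv = <⇒≱ safe
        (≤-trans (E-caught t mv) (≤-trans (∑-pick (λ i → D t r (loc (cs i))) i) (m≤m+n _ _)))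

      -- Induction on the cops' winning strategy, which is well-founded: each round replaces it by a
      -- smaller one for a position that is safe again.
      evade : ∀ {T cs v} → t ≤ T → CopWin graph T cs v → ∀ r → v ≡ at r → Safe cs r → ⊥
      evade t≤T (caught (i , e)) r refl safe = safe⇒not-reached safe i (inj₁ (sym (trans (cong loc e) (loc-at r))))
      evade {cs = cs} t≤T (play cs' mv (inj₁ (i , e))) r refl safe =
        safe⇒not-reached safe i (subst (Move (loc (cs i))) (trans (cong loc e) (loc-at r)) (copMove-loc {cs = cs} {cs'} mv i))
      evade t≤T (play cs' mv (inj₂ next)) r refl safe =
        let r' , path , safe' = respond r mv safe in evade t≤T (next (at r') (robPath-mono t≤T path)) r' refl safe'

      robber-wins : ∀ {T} → t ≤ T → V → ¬ CopsWin graph T m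
      robber-wins t≤T r₀ (cs , win) = let r , safe = start r₀ cs in evade t≤T (win (at r)) r refl safe

-- A prime between 4 ^ a and 4 ^ (2 + a).

module PrimeGaps where

  open import Data.List using ([]; _∷_)
  open import Data.List.Relation.Unary.All using (_∷_)
  open import Data.Nat
  open import Data.Nat.Properties
  open import Data.Nat.Combinatorics using (_C_; nCk+nC[k+1]≡[n+1]C[k+1]; nCk≡n!/k![n-k]!; k>n⇒nCk≡0; k![n∸k]!∣n!; nC1≡n)
  open import Data.Nat.Divisibility
  open import Data.Nat.DivMod using (m/n*n≡m)
  open import Data.Nat.Induction using (<-rec)
  open import Data.Nat.Primality using (Prime; prime?; euclidsLemma; prime⇒nonZero; prime⇒nonTrivial)
  open import Data.Nat.Primality.Factorisation using (factorise)
  open import Data.Nat.Tactic.RingSolver using (solve-∀)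
  open import Data.Product using (∃; _×_; _,_)
  open import Data.Sum using (inj₁; inj₂)
  open import Relation.Binary.PropositionalEquality using (_≡_; refl; sym; trans; cong; cong₂; subst; module ≡-Reasoning)
  open import Relation.Nullary using (¬_; yes; no; contradiction)
  open import Relation.Nullary.Decidable using (_×-dec_)

  pascal : ∀ n k → suc n C suc k ≡ n C k + n C suc k
  pascal n k = sym (nCk+nC[k+1]≡[n+1]C[k+1] n k)

  C-absorb : ∀ n k → suc k * (suc n C suc k) ≡ suc n * (n C k)
  C-absorb zero    zero    = refl
  C-absorb zero    (suc k) = trans (cong (suc (suc k) *_) (k>n⇒nCk≡0 {1} {suc (suc k)} (s≤s (s≤s z≤n)))) (trans (*-zeroʳ (suc (suc k))) refl)
  C-absorb (suc n) zero    = trans (*-identityˡ (suc (suc n) C 1)) (trans (nC1≡n (suc (suc n))) (sym (*-identityʳ (suc (suc n)))))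
  C-absorb (suc n) (suc k) = begin
    (2 + k) * (suc (suc n) C (2 + k))                            ≡⟨ cong ((2 + k) *_) (pascal (suc n) (suc k)) ⟩
    (2 + k) * ((suc n C suc k) + (suc n C (2 + k)))              ≡⟨ eq₁ k (suc n C suc k) (suc n C (2 + k)) ⟩
    (suc n C suc k) + (suc k * (suc n C suc k) + (2 + k) * (suc n C (2 + k)))
      ≡⟨ cong ((suc n C suc k) +_) (cong₂ _+_ (C-absorb n k) (C-absorb n (suc k))) ⟩
    (suc n C suc k) + (suc n * (n C k) + suc n * (n C suc k))    ≡⟨ cong ((suc n C suc k) +_) (*-distribˡ-+ (suc n) (n C k) (n C suc k)) ⟨
    (suc n C suc k) + suc n * ((n C k) + (n C suc k))            ≡⟨ cong (λ c → (suc n C suc k) + suc n * c) (pascal n k) ⟨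
    (2 + n) * (suc n C suc k)                                    ∎
    where
    open ≡-Reasoning
    eq₁ : ∀ k x y → (2 + k) * (x + y) ≡ x + ((1 + k) * x + (2 + k) * y)
    eq₁ = solve-∀

  C-≤2^ : ∀ n k → n C k ≤ 2 ^ n
  C-≤2^ n       zero    = m^n>0 2 n
  C-≤2^ zero    (suc k) = z≤n
  C-≤2^ (suc n) (suc k) = begin
    suc n C suc k       ≡⟨ pascal n k ⟩
    n C k + n C suc k   ≤⟨ +-mono-≤ (C-≤2^ n k) (C-≤2^ n (suc k)) ⟩
    2 ^ n + 2 ^ n       ≡⟨ cong (2 ^ n +_) (+-identityʳ (2 ^ n)) ⟨
    2 ^ suc n           ∎
    where open ≤-Reasoning

  central-≥2^ : ∀ n → 2 ^ n ≤ (n + n) C n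
  central-≥2^ zero    = ≤-refl
  central-≥2^ (suc n) = begin
    2 ^ n + (2 ^ n + 0)                                   ≡⟨ cong (2 ^ n +_) (+-identityʳ (2 ^ n)) ⟩
    2 ^ n + 2 ^ n                                         ≤⟨ +-mono-≤ (central-≥2^ n) (central-≥2^ n) ⟩
    (n + n) C n + (n + n) C n                             ≤⟨ +-mono-≤ (lower n) (≤-trans (m≤m+n _ _) (≤-reflexive (sym (pascal (n + n) n)))) ⟩
    suc (n + n) C n + suc (n + n) C suc n                 ≡⟨ pascal (suc (n + n)) n ⟨
    suc (suc (n + n)) C suc n                             ≡⟨ cong (λ k → suc k C suc n) (+-suc n n) ⟨
    (suc n + suc n) C suc n                               ∎
    where
    open ≤-Reasoning
    lower : ∀ {m} k → m C k ≤ suc m C k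
    lower     zero    = ≤-refl
    lower {m} (suc k) = ≤-trans (m≤n+m _ _) (≤-reflexive (sym (pascal m k)))

  C-positive : ∀ {n k} → k ≤ n → 0 < n C k
  C-positive {n}     {zero}  _         = s≤s z≤n
  C-positive {suc n} {suc k} (s≤s k≤n) = ≤-trans (C-positive k≤n) (≤-trans (m≤m+n _ _) (≤-reflexive (sym (pascal n k))))

  -- The harmonic triangle: 1/w = 1/u - 1/v.
  harmonic-∣ : ∀ {u v w M} .{{_ : NonZero u}} → u ∣ M → v ∣ M → v * w ≡ u * (v + w) → w ∣ M
  harmonic-∣ {u} {v} {w} {M} (divides s M≡su) (divides r M≡rv) e =
    ∣m+n∣m⇒∣n (subst (w ∣_) sw≡rw+M (n∣m*n s)) (n∣m*n r)
    where
    open ≡-Reasoning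
    eq₁ : ∀ u s w → u * (s * w) ≡ (s * u) * w
    eq₁ = solve-∀
    eq₂ : ∀ r v w → (r * v) * w ≡ r * (v * w)
    eq₂ = solve-∀
    eq₃ : ∀ r u v w → r * (u * (v + w)) ≡ u * (r * w + r * v)
    eq₃ = solve-∀

    sw≡rw+M : s * w ≡ r * w + M
    sw≡rw+M = *-cancelˡ-≡ (s * w) (r * w + M) u (begin
      u * (s * w)           ≡⟨ eq₁ u s w ⟩
      (s * u) * w           ≡⟨ cong (_* w) (trans (sym M≡su) M≡rv) ⟩
      (r * v) * w           ≡⟨ eq₂ r v w ⟩
      r * (v * w)           ≡⟨ cong (r *_) e ⟩
      r * (u * (v + w))     ≡⟨ eq₃ r u v w ⟩
      u * (r * w + r * v)   ≡⟨ cong (λ k → u * (r * w + k)) M≡rv ⟨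
      u * (r * w + M)       ∎)

  -- The reciprocals of these products form Leibniz's harmonic triangle: its first column is 1/n,
  -- and each further entry is a difference of two entries of the column before.
  binomial-∣ : ∀ {m M} → (∀ j → 0 < j → j ≤ m → j ∣ M) → ∀ k n → suc k ≤ n → n ≤ m → suc k * (n C suc k) ∣ M
  binomial-∣ h zero    n       k<n n≤m = subst (_∣ _) (sym (trans (*-identityˡ (n C 1)) (nC1≡n n))) (h n k<n n≤m)
  binomial-∣ {M = M} h (suc k) (suc n) (s≤s k<n) n<m =
    harmonic-∣ {{m*n≢0 (suc k) (n C suc k) {{_}} {{>-nonZero (C-positive k<n)}}}}
      (binomial-∣ h k n k<n (<⇒≤ n<m)) (binomial-∣ h k (suc n) (m≤n⇒m≤1+n k<n) n<m) (begin
        (suc k * (suc n C suc k)) * (suc (suc k) * (suc n C suc (suc k)))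
          ≡⟨ cong ((suc k * (suc n C suc k)) *_) (C-absorb n (suc k)) ⟩
        (suc k * (suc n C suc k)) * (suc n * (n C suc k))
          ≡⟨ eq₁ k (suc n C suc k) (suc n) (n C suc k) ⟩
        (suc k * (n C suc k)) * (suc n * (suc n C suc k))
          ≡⟨ cong (λ c → (suc k * (n C suc k)) * (suc n * c)) (pascal n k) ⟩
        (suc k * (n C suc k)) * (suc n * ((n C k) + (n C suc k)))
          ≡⟨ cong ((suc k * (n C suc k)) *_) (*-distribˡ-+ (suc n) (n C k) (n C suc k)) ⟩
        (suc k * (n C suc k)) * (suc n * (n C k) + suc n * (n C suc k))
          ≡⟨ cong ((suc k * (n C suc k)) *_) (cong₂ _+_ (C-absorb n k) (C-absorb n (suc k))) ⟨
        (suc k * (n C suc k)) * (suc k * (suc n C suc k) + suc (suc k) * (suc n C suc (suc k))) ∎)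
    where
    open ≡-Reasoning
    eq₁ : ∀ k a n b → ((1 + k) * a) * (n * b) ≡ ((1 + k) * b) * (n * a)
    eq₁ = solve-∀

  module _ {p} (prime : Prime p) where
    private instance
      p≢0 = prime⇒nonZero prime
      p≢1 = prime⇒nonTrivial prime

    prime-power-∣-cancel : ∀ {b} → ¬ p ∣ b → ∀ e c → p ^ e ∣ b * c → p ^ e ∣ c
    prime-power-∣-cancel         p∤b zero    c h = 1∣ c
    prime-power-∣-cancel {b} p∤b (suc e) c h with euclidsLemma b c prime (∣-trans (m∣m*n (p ^ e)) h)
    ... | inj₁ p∣b = contradiction p∣b p∤b
    ... | inj₂ (divides d refl) = subst (p ^ suc e ∣_) (*-comm p d)
      (*-monoʳ-∣ p (prime-power-∣-cancel p∤b e d (*-cancelˡ-∣ p (subst (p ^ suc e ∣_) (eq b d p) h))))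
      where
      eq : ∀ b d p → b * (d * p) ≡ p * (b * d)
      eq = solve-∀

    extract : ∀ n → .{{NonZero n}} → ∃ λ e → ∃ λ b → n ≡ p ^ e * b × ¬ p ∣ b
    extract = <-rec (λ n → .{{NonZero n}} → ∃ λ e → ∃ λ b → n ≡ p ^ e * b × ¬ p ∣ b) go
      where
      go : ∀ n → (∀ {k} → k < n → .{{NonZero k}} → ∃ λ e → ∃ λ b → k ≡ p ^ e * b × ¬ p ∣ b) →
           .{{NonZero n}} → ∃ λ e → ∃ λ b → n ≡ p ^ e * b × ¬ p ∣ b
      go n rec with p ∣? n
      ... | no p∤n  = 0 , n , sym (*-identityˡ n) , p∤n
      ... | yes p∣n =
        let e , b , k≡ , p∤b = rec (quotient-< p∣n) {{quotient≢0 p∣n}}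
        in suc e , b , trans (m∣n⇒n≡m*quotient p∣n) (trans (cong (p *_) k≡) (sym (*-assoc p (p ^ e) b))) , p∤b

    ∤! : ∀ n → n < p → ¬ p ∣ n !
    ∤! zero    _   h = contradiction (∣1⇒≡1 h) (nonTrivial⇒≢1 {p})
    ∤! (suc n) n<p h with euclidsLemma (suc n) (n !) prime h
    ... | inj₁ p∣ = contradiction p∣ (>⇒∤ n<p)
    ... | inj₂ p∣ = ∤! n (<-trans (n<1+n n) n<p) p∣

    ∣! : ∀ n → p ≤ n → p ∣ n !
    ∣! n p≤n = ∣-trans (lemma p) (m≤n⇒m!∣n! p≤n)
      where
      lemma : ∀ k → .{{NonZero k}} → k ∣ k !
      lemma (suc k) = m∣m*n (k !)

    -- Such a p divides (n + n)! but neither of the two factors n ! in the denominator.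
    ∣-central : ∀ n → n < p → p ≤ n + n → p ∣ (n + n) C n
    ∣-central n n<p p≤2n with euclidsLemma ((n + n) C n) (n ! * n !) prime (subst (p ∣_) (sym product) (∣! (n + n) p≤2n))
      where
      open ≡-Reasoning
      instance
        _ = n !* (n + n ∸ n) !≢0
      product : ((n + n) C n) * (n ! * n !) ≡ (n + n) !
      product = begin
        ((n + n) C n) * (n ! * n !)                       ≡⟨ cong (λ k → ((n + n) C n) * (n ! * k !)) (m+n∸n≡m n n) ⟨
        ((n + n) C n) * (n ! * (n + n ∸ n) !)             ≡⟨ cong (_* (n ! * (n + n ∸ n) !)) (nCk≡n!/k![n-k]! (m≤m+n n n)) ⟩
        ((n + n) ! / (n ! * (n + n ∸ n) !)) * (n ! * (n + n ∸ n) !) ≡⟨ m/n*n≡m (k![n∸k]!∣n! (m≤m+n n n)) ⟩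
        (n + n) !                                       ∎
    ... | inj₁ p∣ = p∣
    ... | inj₂ p∣ with euclidsLemma (n !) (n !) prime p∣
    ...   | inj₁ p∣! = contradiction p∣! (∤! n n<p)
    ...   | inj₂ p∣! = contradiction p∣! (∤! n n<p)

  prime-divisor : ∀ n → 1 < n → ∃ λ p → Prime p × p ∣ n
  prime-divisor n 1<n with factorise n {{>-nonZero (<⇒≤ 1<n)}}
  ... | record { factors = [] ; isFactorisation = e } = contradiction (sym e) (<⇒≢ 1<n)
  ... | record { factors = p ∷ ps ; isFactorisation = e ; factorsPrime = pr ∷ _ } = p , pr , subst (p ∣_) (sym e) (m∣m*n _)

  prime-powers⇒∣ : ∀ M j → .{{NonZero j}} → (∀ p e → Prime p → p ^ e ∣ j → p ^ e ∣ M) → j ∣ M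
  prime-powers⇒∣ M = <-rec (λ j → .{{NonZero j}} → (∀ p e → Prime p → p ^ e ∣ j → p ^ e ∣ M) → j ∣ M) go
    where
    go : ∀ j → (∀ {k} → k < j → .{{NonZero k}} → (∀ p e → Prime p → p ^ e ∣ k → p ^ e ∣ M) → k ∣ M) →
         .{{NonZero j}} → (∀ p e → Prime p → p ^ e ∣ j → p ^ e ∣ M) → j ∣ M
    go j rec h with 1 <? j
    ... | no 1≮j = subst (_∣ M) (≤-antisym (>-nonZero⁻¹ j) (≮⇒≥ 1≮j)) (1∣ M)
    ... | yes 1<j with prime-divisor j 1<j
    ...   | p , pr , p∣j with extract pr j
    ...     | zero , b , j≡ , p∤b = contradiction (subst (p ∣_) (trans j≡ (*-identityˡ b)) p∣j) p∤b
    ...     | suc e , zero , j≡ , p∤b = contradiction (p ∣0) p∤b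
    ...     | suc e , b@(suc _) , j≡ , p∤b = subst (_∣ M) (sym j≡) p^eb∣M
      where
      b∣j : b ∣ j
      b∣j = subst (b ∣_) (sym j≡) (n∣m*n (p ^ suc e))

      b<j : b < j
      b<j = subst (b <_) (sym j≡) (≤-trans (≤-reflexive (cong suc (sym (*-identityˡ b))))
        (*-monoˡ-< b (≤-trans (nonTrivial⇒n>1 p {{prime⇒nonTrivial pr}}) (m≤m*n p (p ^ e) {{m^n≢0 p e {{prime⇒nonZero pr}}}}))))

      b∣M : b ∣ M
      b∣M = rec b<j (λ p' e' pr' d → h p' e' pr' (∣-trans d b∣j))

      p^eb∣M : p ^ suc e * b ∣ M
      p^eb∣M with b∣M
      ... | divides c refl = *-monoˡ-∣ b (prime-power-∣-cancel pr p∤b (suc e) c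
        (subst (p ^ suc e ∣_) (*-comm c b) (h p (suc e) pr (subst (p ^ suc e ∣_) (sym j≡) (m∣m*n b)))))

  ^-pres-∣ : ∀ {m n} e → m ∣ n → m ^ e ∣ n ^ e
  ^-pres-∣ zero    h = ∣-refl
  ^-pres-∣ (suc e) h = *-pres-∣ h (^-pres-∣ e h)

  ^-monoʳ-∣ : ∀ m {e f} → e ≤ f → m ^ e ∣ m ^ f
  ^-monoʳ-∣ m {e} {f} e≤f = subst (m ^ e ∣_) (trans (sym (^-distribˡ-+-* m e (f ∸ e))) (cong (m ^_) (m+[n∸m]≡n e≤f))) (m∣m*n _)

  ^-cancelʳ-≤ : ∀ m {e f} → 1 < m → m ^ e ≤ m ^ f → e ≤ f
  ^-cancelʳ-≤ m {e} {f} 1<m h with e ≤? f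
  ... | yes e≤f = e≤f
  ... | no e≰f  = contradiction h (<⇒≱ (^-monoʳ-< m 1<m (≰⇒> e≰f)))

  n!≤n^n : ∀ n → n ! ≤ n ^ n
  n!≤n^n n = bound n n ≤-refl
    where
    bound : ∀ k n → k ≤ n → k ! ≤ n ^ k
    bound zero    n _   = ≤-refl
    bound (suc k) n k<n = *-mono-≤ k<n (bound k n (<⇒≤ k<n))

  -- Every prime up to 2 ^ A lies in some (2 ^ i , 2 ^ (i + 1)] with i < A, so it divides W A.
  W : ℕ → ℕ
  W zero    = 1
  W (suc i) = W i * ((2 ^ i + 2 ^ i) C 2 ^ i)

  2^suc : ∀ i → 2 ^ suc i ≡ 2 ^ i + 2 ^ i
  2^suc i = cong (2 ^ i +_) (+-identityʳ (2 ^ i))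

  prime-∣W : ∀ {p} → Prime p → ∀ A → p ≤ 2 ^ A → p ∣ W A
  prime-∣W {p} pr zero    p≤1 = contradiction p≤1 (<⇒≱ (nonTrivial⇒n>1 p {{prime⇒nonTrivial pr}}))
  prime-∣W {p} pr (suc i) p≤ with p ≤? 2 ^ i
  ... | yes p≤2^i = ∣m⇒∣m*n _ (prime-∣W pr i p≤2^i)
  ... | no p≰2^i  = ∣n⇒∣m*n (W i) (∣-central pr (2 ^ i) (≰⇒> p≰2^i) (subst (p ≤_) (2^suc i) p≤))

  W-≤ : ∀ A → W A ≤ 2 ^ (2 ^ A + 2 ^ A)
  W-≤ zero    = s≤s z≤n
  W-≤ (suc i) = begin
    W i * ((2 ^ i + 2 ^ i) C 2 ^ i)                ≤⟨ *-mono-≤ (W-≤ i) (C-≤2^ (2 ^ i + 2 ^ i) (2 ^ i)) ⟩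
    2 ^ (2 ^ i + 2 ^ i) * 2 ^ (2 ^ i + 2 ^ i)      ≡⟨ ^-distribˡ-+-* 2 (2 ^ i + 2 ^ i) (2 ^ i + 2 ^ i) ⟨
    2 ^ ((2 ^ i + 2 ^ i) + (2 ^ i + 2 ^ i))        ≡⟨ cong (λ k → 2 ^ (k + k)) (2^suc i) ⟨
    2 ^ (2 ^ suc i + 2 ^ suc i)                    ∎
    where open ≤-Reasoning

  W-positive : ∀ A → 0 < W A
  W-positive zero    = s≤s z≤n
  W-positive (suc i) = *-mono-≤ (W-positive i) (C-positive (m≤m+n (2 ^ i) (2 ^ i)))

  -- Here the threshold 7 originates: it is the first a for which the inequality holds, with 324 <
  -- 384.
  quadratic<exponential : ∀ a → 7 ≤ a → 4 * ((2 + a) * (2 + a)) < 3 * 2 ^ a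
  quadratic<exponential a 7≤a = subst (λ a → 4 * ((2 + a) * (2 + a)) < 3 * 2 ^ a) (m+[n∸m]≡n 7≤a) (go (a ∸ 7))
    where
    open ≤-Reasoning

    eq : ∀ b → 2 * (4 * ((9 + b) * (9 + b))) ≡ 4 * ((10 + b) * (10 + b)) + (248 + 64 * b + 4 * (b * b))
    eq = solve-∀

    go : ∀ b → 4 * ((9 + b) * (9 + b)) < 3 * 2 ^ (7 + b)
    go zero    = m≤m+n 325 59
    go (suc b) = begin-strict
      4 * ((10 + b) * (10 + b))                                       ≤⟨ m≤m+n _ _ ⟩
      4 * ((10 + b) * (10 + b)) + (248 + 64 * b + 4 * (b * b))        ≡⟨ eq b ⟨
      2 * (4 * ((9 + b) * (9 + b)))                                   <⟨ *-monoʳ-< 2 (go b) ⟩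
      2 * (3 * 2 ^ (7 + b))                                           ≡⟨ *-assoc 2 3 (2 ^ (7 + b)) ⟨
      3 * 2 * 2 ^ (7 + b)                                             ≡⟨ *-assoc 3 2 (2 ^ (7 + b)) ⟩
      3 * 2 ^ (8 + b)                                                 ≡⟨ cong (λ k → 3 * 2 ^ k) (+-suc 7 b) ⟨
      3 * 2 ^ (7 + suc b)                                             ∎

  -- If there were no such prime, every j ≤ 4 ^ (2 + a) would divide M, and hence so would n * ((n + n) C n)
  -- for n = 4 ^ (2 + a) / 2, which is too large.
  prime-between : ∀ a → 7 ≤ a → ∃ λ p → Prime p × 4 ^ a < p × p ≤ 4 ^ (2 + a)
  prime-between a 7≤a with anyUpTo? (λ p → prime? p ×-dec (4 ^ a <? p)) (suc (4 ^ (2 + a)))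
  ... | yes (p , s≤s p≤ , pr , a<p) = p , pr , a<p , p≤
  ... | no none = contradiction n≤K (<⇒≱ K<n)
    where
    open ≤-Reasoning

    h s b n K M : ℕ
    h = 2 + a
    s = 2 ^ h
    b = 2 ^ a
    n = 2 * 4 ^ (1 + a)
    K = h * s * (2 * h) + (2 ^ (2 * a) + 2 ^ (2 * a))
    -- For prime powers up to 4 ^ h = s * s: a prime p ≤ s divides s ! and has exponent at most 2 *
    -- h. A larger prime has exponent at most 1 and, if the gap contains no prime, is at most 4 ^ a
    -- and divides `W (2 * a)`.
    M = (s !) ^ (2 * h) * W (2 * a)

    4^≡ : ∀ c → 4 ^ c ≡ 2 ^ (2 * c)
    4^≡ c = ^-*-assoc 2 2 c

    4^h≡s*s : 4 ^ h ≡ s * s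
    4^h≡s*s = trans (4^≡ h) (trans (cong (λ k → 2 ^ (h + k)) (+-identityʳ h)) (^-distribˡ-+-* 2 h h))

    prime-power : ∀ p e → Prime p → p ^ e ≤ 4 ^ h → p ^ e ∣ M
    prime-power p zero    pr _ = 1∣ M
    prime-power p (suc e) pr p^e≤ with p ≤? s
    ... | yes p≤s = ∣m⇒∣m*n (W (2 * a)) (∣-trans (^-pres-∣ (suc e) (∣! pr s p≤s)) (^-monoʳ-∣ (s !) e≤2h))
      where
      e≤2h : suc e ≤ 2 * h
      e≤2h = ^-cancelʳ-≤ 2 (s≤s (s≤s z≤n))
        (≤-trans (^-monoˡ-≤ (suc e) (nonTrivial⇒n>1 p {{prime⇒nonTrivial pr}})) (≤-trans p^e≤ (≤-reflexive (4^≡ h))))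
    prime-power p (suc zero) pr p≤ | no p≰s =
      ∣n⇒∣m*n ((s !) ^ (2 * h)) (subst (_∣ W (2 * a)) (sym (*-identityʳ p)) (prime-∣W pr (2 * a) (subst (p ≤_) (4^≡ a) p≤4^a)))
      where
      p≤4^a : p ≤ 4 ^ a
      p≤4^a with p ≤? 4 ^ a
      ... | yes p≤4^a = p≤4^a
      ... | no p≰4^a  = contradiction (p , s≤s (subst (_≤ 4 ^ h) (*-identityʳ p) p≤) , pr , ≰⇒> p≰4^a) none
    prime-power p (suc (suc e)) pr p^e≤ | no p≰s = contradiction p^e≤ (<⇒≱ (begin-strict
      4 ^ h               ≡⟨ 4^h≡s*s ⟩
      s * s               <⟨ *-mono-< (≰⇒> p≰s) (≰⇒> p≰s) ⟩
      p * p               ≡⟨ cong (p *_) (*-identityʳ p) ⟨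
      p ^ 2               ≤⟨ ^-monoʳ-≤ p {{prime⇒nonZero pr}} (s≤s (s≤s (z≤n {e}))) ⟩
      p ^ suc (suc e)     ∎))

    all-∣ : ∀ j → 0 < j → j ≤ 4 ^ h → j ∣ M
    all-∣ j 0<j j≤ = prime-powers⇒∣ M j {{>-nonZero 0<j}} (λ p e pr d → prime-power p e pr (≤-trans (∣⇒≤ {{>-nonZero 0<j}} d) j≤))

    n-central-∣ : ∀ n → 0 < n → n + n ≤ 4 ^ h → n * ((n + n) C n) ∣ M
    n-central-∣ (suc n) _ = binomial-∣ all-∣ n (suc n + suc n) (m≤m+n (suc n) (suc n))

    0<n : 0 < n
    0<n = *-mono-≤ (s≤s (z≤n {1})) (m^n>0 4 (1 + a))

    n+n≡ : ∀ x → 2 * x + 2 * x ≡ 4 * x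
    n+n≡ = solve-∀

    M≢0 : NonZero M
    M≢0 = m*n≢0 ((s !) ^ (2 * h)) (W (2 * a)) {{m^n≢0 (s !) (2 * h) {{s !≢0}}}} {{>-nonZero (W-positive (2 * a))}}

    M≤ : M ≤ 2 ^ K
    M≤ = begin
      (s !) ^ (2 * h) * W (2 * a)                                       ≤⟨ *-mono-≤ (^-monoˡ-≤ (2 * h) (n!≤n^n s)) (W-≤ (2 * a)) ⟩
      (s ^ s) ^ (2 * h) * 2 ^ (2 ^ (2 * a) + 2 ^ (2 * a))               ≡⟨ cong (λ k → k ^ (2 * h) * 2 ^ (2 ^ (2 * a) + 2 ^ (2 * a))) (^-*-assoc 2 h s) ⟩
      (2 ^ (h * s)) ^ (2 * h) * 2 ^ (2 ^ (2 * a) + 2 ^ (2 * a))         ≡⟨ cong (_* 2 ^ (2 ^ (2 * a) + 2 ^ (2 * a))) (^-*-assoc 2 (h * s) (2 * h)) ⟩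
      2 ^ (h * s * (2 * h)) * 2 ^ (2 ^ (2 * a) + 2 ^ (2 * a))           ≡⟨ ^-distribˡ-+-* 2 (h * s * (2 * h)) (2 ^ (2 * a) + 2 ^ (2 * a)) ⟨
      2 ^ K                                                             ∎

    n≤K : n ≤ K
    n≤K = ^-cancelʳ-≤ 2 (s≤s (s≤s z≤n)) (begin
      2 ^ n                   ≤⟨ central-≥2^ n ⟩
      (n + n) C n             ≤⟨ m≤n*m _ n {{>-nonZero 0<n}} ⟩
      n * ((n + n) C n)       ≤⟨ ∣⇒≤ {{M≢0}} (n-central-∣ n 0<n (≤-reflexive (n+n≡ (4 ^ (1 + a))))) ⟩
      M                       ≤⟨ M≤ ⟩
      2 ^ K                   ∎)

    2^2a≡b*b : 2 ^ (2 * a) ≡ b * b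
    2^2a≡b*b = trans (cong (λ k → 2 ^ (a + k)) (+-identityʳ a)) (^-distribˡ-+-* 2 a a)

    eq₁ : ∀ h b → h * (2 * (2 * b)) * (2 * h) + (b * b + b * b) ≡ 2 * b * (4 * (h * h)) + 2 * (b * b)
    eq₁ = solve-∀

    eq₂ : ∀ b → 2 * b * (3 * b) + 2 * (b * b) ≡ 2 * (4 * (b * b))
    eq₂ = solve-∀

    instance
      2b≢0 : NonZero (2 * b)
      2b≢0 = m*n≢0 2 b {{_}} {{m^n≢0 2 a}}

    -- With b = 2 ^ a, the first summand of K is 2 b * (4 h ^ 2), less than 6 b ^ 2; the second is 2
    -- b ^ 2; and n is 8 b ^ 2.
    K<n : K < n
    K<n = begin-strict
      h * s * (2 * h) + (2 ^ (2 * a) + 2 ^ (2 * a))       ≡⟨ cong (λ k → h * s * (2 * h) + (k + k)) 2^2a≡b*b ⟩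
      h * (2 * (2 * b)) * (2 * h) + (b * b + b * b)       ≡⟨ eq₁ h b ⟩
      2 * b * (4 * (h * h)) + 2 * (b * b)                 <⟨ +-monoˡ-< (2 * (b * b)) (*-monoʳ-< (2 * b) (quadratic<exponential a 7≤a)) ⟩
      2 * b * (3 * b) + 2 * (b * b)                       ≡⟨ eq₂ b ⟩
      2 * (4 * (b * b))                                   ≡⟨ cong (λ k → 2 * (4 * k)) (trans (4^≡ a) 2^2a≡b*b) ⟨
      2 * (4 * 4 ^ a)                                     ∎

-- From graphs for primes to graphs of every order.

module LowerBound where

  open import Data.Bool using (true)
  open import Data.Fin as Fin using (Fin; zero; suc)
  import Data.Fin.Properties as Fin
  open import Data.Nat
  open import Data.Nat.Properties
  open import Data.Nat.Primality using (Prime; prime⇒nonZero)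
  open import Data.Nat.Tactic.RingSolver using (solve-∀)
  open import Data.Product using (Σ; ∃; _×_; _,_)
  open import Data.Sum using (inj₁; inj₂)
  open import Function using (_∘_)
  open import Relation.Binary.PropositionalEquality using (_≡_; _≢_; refl; sym; trans; cong; cong₂; subst)
  open import Relation.Nullary using (¬_; yes; no; contradiction)
  open Colourings using (Coloured; module Words; module Tower)
  open Counting using (C)
  open Pursuit

  completeGraph : ∀ n → Graph n
  completeGraph n = record { Adj = _≢_ ; sym = λ u≢v → u≢v ∘ sym ; irrefl = λ u≢u → u≢u refl }

  completeGraph-connected : ∀ n → Connected (completeGraph n)
  completeGraph-connected n u v with u Fin.≟ v
  ... | yes refl = here
  ... | no u≢v   = step u≢v here

  no-cops : ∀ {n T} {G : Graph n} {cs : Cops n 0} {r} → ¬ CopWin G T cs r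
  no-cops         (caught (() , _))
  no-cops         (play cs' mv (inj₁ (() , _)))
  no-cops {r = r} (play cs' mv (inj₂ next)) = no-cops (next r stay)

  cops-needed : ∀ {n T m} {G : Graph n} → 1 ≤ n → CopsWin G T m → 1 ≤ m
  cops-needed {suc n} {m = zero}  _ (cs , win) = contradiction (win zero) no-cops
  cops-needed {suc n} {m = suc m} _ _ = s≤s z≤n

  ^-distribʳ-* : ∀ m n k → (m * n) ^ k ≡ m ^ k * n ^ k
  ^-distribʳ-* m n zero    = refl
  ^-distribʳ-* m n (suc k) = trans (cong (m * n *_) (^-distribʳ-* m n k)) (eq m n (m ^ k) (n ^ k))
    where
    eq : ∀ m n x y → m * n * (x * y) ≡ m * x * (n * y)
    eq = solve-∀

  bracket : ∀ (f : ℕ → ℕ) → (∀ a → a ≤ f a) → ∀ a₀ n → f a₀ ≤ n → ∃ λ a → a₀ ≤ a × f a ≤ n × n < f (suc a)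
  bracket f a≤fa a₀ n fa₀≤n = go (suc n) a₀ ≤-refl fa₀≤n (≤-trans (m≤n+m (suc n) a₀) (a≤fa (a₀ + suc n)))
    where
    go : ∀ d a → a₀ ≤ a → f a ≤ n → n < f (a + d) → ∃ λ a → a₀ ≤ a × f a ≤ n × n < f (suc a)
    go zero    a a₀≤a fa≤n n<f = contradiction fa≤n (<⇒≱ (subst (λ k → n < f k) (+-identityʳ a) n<f))
    go (suc d) a a₀≤a fa≤n n<f with f (suc a) ≤? n
    ... | no fa'≰n  = a , a₀≤a , fa≤n , ≰⇒> fa'≰n
    ... | yes fa'≤n = go d (suc a) (m≤n⇒m≤1+n a₀≤a) fa'≤n (subst (λ k → n < f k) (+-suc a d) n<f)

  n≤4^n : ∀ n → n ≤ 4 ^ n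
  n≤4^n zero    = z≤n
  n≤4^n (suc n) = +-mono-≤ (m^n>0 4 n) (≤-trans (n≤4^n n) (m≤m+n _ _))

  record HighGirth (t p : ℕ) : Set₁ where
    field
      structure : Coloured p
      size≡     : Coloured.size structure ≡ 2 * p ^ suc t
      vertex    : Coloured.V structure
      unique    : ∀ {n} → n ≤ suc t → Words.Unique structure n

  module _ (t : ℕ) (family : ∀ p → Prime p → HighGirth t p)
           (a₀ : ℕ) (primes : ∀ a → a₀ ≤ a → ∃ λ p → Prime p × 4 ^ a < p × p ≤ 4 ^ (2 + a)) (4t≤ : 4 * suc t ≤ 4 ^ a₀)
           {T : ℕ} (t≤T : t ≤ T) where

    -- 4 p ^ (t + 1) + 1 vertices suffice for every p ≤ 4 ^ (2 + a).
    vertices : ℕ → ℕ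
    vertices a = suc (4 * (4 ^ (2 + a)) ^ suc t)

    a≤vertices : ∀ a → a ≤ vertices a
    a≤vertices a = begin
      a                              ≤⟨ m≤n+m a 2 ⟩
      2 + a                          ≤⟨ n≤4^n (2 + a) ⟩
      4 ^ (2 + a)                    ≡⟨ ^-identityʳ (4 ^ (2 + a)) ⟨
      (4 ^ (2 + a)) ^ 1              ≤⟨ ^-monoʳ-≤ (4 ^ (2 + a)) {{m^n≢0 4 (2 + a)}} (s≤s (z≤n {t})) ⟩
      (4 ^ (2 + a)) ^ suc t          ≤⟨ m≤n*m _ 4 ⟩
      4 * (4 ^ (2 + a)) ^ suc t      ≤⟨ n≤1+n _ ⟩
      vertices a                     ∎
      where open ≤-Reasoning

    -- B bounds n / p ^ (t + 1): the next size, n < `vertices (suc a)`, allows 4 * (4 ^ (3 + a)) ^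
    -- (t + 1), and 4 ^ (3 + a) ≤ 64 * p. In K, the factor 16 * C t is the loss in the number of
    -- cops, and the summand `vertices a₀` covers the small n.
    B K : ℕ
    B = 4 * 64 ^ suc t
    K = B * (16 * C t) + vertices a₀

    large : ∀ n → vertices a₀ ≤ n → Σ (Graph n) λ G → Connected G × CopNumberAtLeast G T 1 K t (suc t)
    large n n≥ with bracket vertices a≤vertices a₀ n n≥
    ... | a , a₀≤a , va≤n , n<v with primes a a₀≤a
    ...   | p , pr , a<p , p≤ = subst (λ n → Σ (Graph n) λ G → Connected G × CopNumberAtLeast G T 1 K t (suc t)) order≡n
                                  (graph , graph-connected , bound)
      where
      open HighGirth (family p pr)
      open Coloured structure using (size)
      instance
        p≢0 : NonZero p
        p≢0 = prime⇒nonZero pr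
      open Play structure (n ∸ suc (size + size))
      open ≤-Reasoning

      2size≡ : size + size ≡ 4 * p ^ suc t
      2size≡ = trans (cong₂ _+_ size≡ size≡) (eq (p ^ suc t))
        where
        eq : ∀ x → 2 * x + 2 * x ≡ 4 * x
        eq = solve-∀

      fits : suc (size + size) ≤ n
      fits = ≤-trans (s≤s (≤-trans (≤-reflexive 2size≡) (*-monoʳ-≤ 4 (^-monoˡ-≤ (suc t) p≤)))) va≤n

      order≡n : order ≡ n
      order≡n = trans (sym (+-assoc size size _)) (trans (+-suc (size + size) _) (m+[n∸m]≡n fits))

      n≤Bp : n ≤ B * p ^ suc t
      n≤Bp = begin
        n                                ≤⟨ ≤-pred n<v ⟩
        4 * (4 ^ (3 + a)) ^ suc t        ≤⟨ *-monoʳ-≤ 4 (^-monoˡ-≤ (suc t) 4^≤64p) ⟩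
        4 * (64 * p) ^ suc t             ≡⟨ cong (4 *_) (^-distribʳ-* 64 p (suc t)) ⟩
        4 * (64 ^ suc t * p ^ suc t)     ≡⟨ *-assoc 4 (64 ^ suc t) (p ^ suc t) ⟨
        B * p ^ suc t                    ∎
        where
        eq : ∀ x → 4 * (4 * (4 * x)) ≡ 64 * x
        eq = solve-∀

        4^≤64p : 4 ^ (3 + a) ≤ 64 * p
        4^≤64p = ≤-trans (≤-reflexive (eq (4 ^ a))) (*-monoʳ-≤ 64 (<⇒≤ a<p))

      4t≤p : 4 * suc t ≤ p
      4t≤p = ≤-trans 4t≤ (≤-trans (^-monoʳ-≤ 4 a₀≤a) (<⇒≤ a<p))

      p^t≤ : ∀ m → CopsWin graph T m → p ^ t ≤ 16 * (m * C t)
      p^t≤ m win with 16 * (m * C t) ≤? p ^ t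
      ... | yes few  = contradiction win (Robber.robber-wins t unique 4t≤p few t≤T vertex)
      ... | no ¬few = <⇒≤ (≰⇒> ¬few)

      bound : CopNumberAtLeast graph T 1 K t (suc t)
      bound m win = begin
        1 ^ suc t * order ^ t               ≡⟨ trans (cong (_* order ^ t) (^-zeroˡ (suc t))) (*-identityˡ (order ^ t)) ⟩
        order ^ t                           ≡⟨ cong (_^ t) order≡n ⟩
        n ^ t                               ≤⟨ ^-monoˡ-≤ t n≤Bp ⟩
        (B * p ^ suc t) ^ t                 ≡⟨ ^-distribʳ-* B (p ^ suc t) t ⟩
        -- Exchanging the exponents turns the order p ^ (t + 1) of the graph into the bound p ^ t
        -- for the cops.
        B ^ t * (p ^ suc t) ^ t             ≡⟨ cong (B ^ t *_) (trans (^-*-assoc p (suc t) t) (trans (cong (p ^_) (*-comm (suc t) t)) (sym (^-*-assoc p t (suc t))))) ⟩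
        B ^ t * (p ^ t) ^ suc t             ≤⟨ *-monoˡ-≤ ((p ^ t) ^ suc t) (^-monoʳ-≤ B {{B≢0}} (n≤1+n t)) ⟩
        B ^ suc t * (p ^ t) ^ suc t         ≡⟨ ^-distribʳ-* B (p ^ t) (suc t) ⟨
        (B * p ^ t) ^ suc t                 ≤⟨ ^-monoˡ-≤ (suc t) (*-monoʳ-≤ B (p^t≤ m win)) ⟩
        (B * (16 * (m * C t))) ^ suc t      ≡⟨ cong (_^ suc t) (eq B m (C t)) ⟩
        (B * (16 * C t) * m) ^ suc t        ≤⟨ ^-monoˡ-≤ (suc t) (*-monoˡ-≤ m (m≤m+n (B * (16 * C t)) (vertices a₀))) ⟩
        (K * m) ^ suc t                     ∎
        where
        B≢0 : NonZero B
        B≢0 = m*n≢0 4 (64 ^ suc t) {{_}} {{m^n≢0 64 (suc t)}}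

        eq : ∀ B m c → B * (16 * (m * c)) ≡ B * (16 * c) * m
        eq = solve-∀

    -- At least one cop is always needed, and K alone already exceeds or equals n.
    small : ∀ n → 1 ≤ n → n ≤ vertices a₀ → CopNumberAtLeast (completeGraph n) T 1 K t (suc t)
    small n 1≤n n≤ m win = begin
      1 ^ suc t * n ^ t     ≡⟨ trans (cong (_* n ^ t) (^-zeroˡ (suc t))) (*-identityˡ (n ^ t)) ⟩
      n ^ t                 ≤⟨ ^-monoˡ-≤ t n≤Km ⟩
      (K * m) ^ t           ≤⟨ ^-monoʳ-≤ (K * m) {{>-nonZero (≤-trans 1≤n n≤Km)}} (n≤1+n t) ⟩
      (K * m) ^ suc t       ∎
      where
      open ≤-Reasoning
      n≤Km : n ≤ K * m
      n≤Km = ≤-trans n≤ (≤-trans (m≤n+m _ (B * (16 * C t))) (m≤m*n K m {{>-nonZero (cops-needed 1≤n win)}}))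

    lowerBound : Σ ℕ λ p → Σ ℕ λ q → 0 < p × 0 < q ×
      (∀ (n : ℕ) → 1 ≤ n → Σ (Graph n) λ G → Connected G × CopNumberAtLeast G T p q t (suc t))
    lowerBound = 1 , K , s≤s z≤n , ≤-trans (s≤s z≤n) (m≤n+m (vertices a₀) (B * (16 * C t))) , graphs
      where
      graphs : ∀ n → 1 ≤ n → Σ (Graph n) λ G → Connected G × CopNumberAtLeast G T 1 K t (suc t)
      graphs n 1≤n with vertices a₀ ≤? n
      ... | yes n≥ = large n n≥
      ... | no n≱  = completeGraph n , completeGraph-connected n , small n 1≤n (<⇒≤ (≰⇒> n≱))

  quadrangle : ∀ p → Prime p → HighGirth 2 p
  quadrangle p@(suc _) pr = record
    { structure = S₃
    ; size≡     = eq p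
    ; vertex    = ((true , zero) , zero) , zero
    ; unique    = S₃-unique
    }
    where
    open Tower p pr
    eq : ∀ p → 2 * p * p * p ≡ 2 * (p * (p * (p * 1)))
    eq = solve-∀

  hexagon : ∀ p → Prime p → HighGirth 4 p
  hexagon p@(suc _) pr = record
    { structure = S₅
    ; size≡     = eq p
    ; vertex    = ((((true , zero) , zero) , zero) , zero) , zero
    ; unique    = S₅-unique
    }
    where
    open Tower p pr
    eq : ∀ p → 2 * p * p * p * p * p ≡ 2 * (p * (p * (p * (p * (p * 1)))))
    eq = solve-∀

open PrimeGaps using (prime-between)
open LowerBound

mainTheorem3 : (t : ℕ) → 1 ≤ t →
    (2 ≤ t → Σ ℕ λ p → Σ ℕ λ q → 0 < p × 0 < q ×
    (∀ (n : ℕ) → 1 ≤ n → Σ (Graph n) λ G → Connected G × CopNumberAtLeast G t p q 2 3))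
    × (4 ≤ t → Σ ℕ λ p → Σ ℕ λ q → 0 < p × 0 < q ×
    (∀ (n : ℕ) → 1 ≤ n → Σ (Graph n) λ G → Connected G × CopNumberAtLeast G t p q 4 5))
-- The numerals witness 4 * 3 ≤ 4 ^ 7 and 4 * 5 ≤ 4 ^ 7, where 4 ^ 7 = 16384. The remaining argument
-- of each `lowerBound` is the hypothesis 2 ≤ t or 4 ≤ t.
mainTheorem3 t _ = lowerBound 2 quadrangle 7 prime-between (m≤m+n 12 16372) , lowerBound 4 hexagon 7 prime-between (m≤m+n 20 16364)
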